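{- Let $G$ be a connected planar graph. (1) Every polyhedral embedding of $G$ in an orientable surface has genus $0$; that is, $G$ has no polyhedral embedding in any orientable surface but the plane. (2) If $G$ is cubic, then every embedding of $G$ in an orientable surface whose dual graph is simple has genus $0$; that is, cubic planar graphs have no embedding with a simple dual in any orientable surface but the plane.
   Context: Graphs are finite, simple and undirected. A graph is cubic if every vertex has degree $3$. Embeddings in orientable surfaces are described combinatorially (they correspond to 2-cell embeddings). Each undirected edge $\{u,v\}$ is interpreted as two directed edges $e=(u,v)$ and $e^{ -1}=(v,u)$. An embedding of a graph is a choice, for every vertex $u$, of a cyclic order of all directed edges $(u,\cdot)$ starting at $u$ (interpreted as clockwise order). For a directed edge $e$, $\mathrm{nx}(e)$ denotes the next edge after $e$ in the cyclic order around the starting vertex of $e$. A face of an embedding is a directed cyclic walk $e_0,\dots,e_{n-1}$ with $\mathrm{nx}(e_i^{ -1})=e_{(i+1) \bmod n}$ for all $0\le i<n$; i.e. the faces are the orbits of the permutation $e\mapsto \mathrm{nx}(e^{ -1})$ on directed edges. (By convention, the one-vertex graph has exactly one face, the trivial walk, which is not a simple cycle.) The genus of an embedding of a connected graph with $v$ vertices, $e$ undirected edges and $f$ faces is $\gamma=\frac{2-(v-e+f)}{2}$; an embedding of genus $0$ is an embedding in the plane. A graph is planar if it has an embedding of genus $0$. A polyhedral embedding of a graph in an orientable surface is an embedding such that each facial walk is a simple cycle and the intersection of any two distinct faces (as subgraphs, i.e. their common vertices and edges) is either empty, a single vertex, or a single edge (with its two endpoints). The dual graph of an embedding has the faces as vertices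 and, for each undirected edge of $G$ with directed versions $e,e^{ -1}$, one edge joining the face containing $e$ to the face containing $e^{ -1}$. It is simple if it has no loops and no multiple edges. -}

module Defs where

open import Data.Nat.Base using (ℕ; zero; suc; _+_; _*_; _∸_; _≤_; _<_; NonZero; >-nonZero)
import Data.Nat.Properties as ℕ
open import Data.Nat.DivMod using (_/_; _%_; m≡m%n+[m/n]*n; m%n<n)
open import Data.Nat.GeneralisedArithmetic using (fold; fold-+)
import Data.Integer.Base as ℤ
open import Data.Rational.Base as ℚ using (ℚ; 0ℚ)
open import Data.Fin.Base using (Fin; toℕ; fromℕ<; combine)
import Data.Fin.Properties as Fin
open import Data.List.Base
  using (List; []; _∷_; _++_; map; concatMap; filter; length; allFin; deduplicate)
open import Data.Product.Base using (_×_; _,_; ∃-syntax; proj₁; proj₂)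
open import Data.Sum.Base using (_⊎_; inj₁; inj₂)
open import Data.Empty using (⊥)
open import Data.Empty.Irrelevant using () renaming (⊥-elim to ⊥-elim-irr)
open import Function.Definitions using (Injective)
open import Level using (0ℓ)
open import Relation.Nullary using (¬_; yes; no)
open import Relation.Nullary.Decidable using (map′)
open import Relation.Unary using (Pred; _∩_; _≐_; ∅; U; ｛_｝)
open import Relation.Binary.Core using (Rel)
open import Relation.Binary.Bundles using (Setoid)
open import Relation.Binary.Definitions
  using (Decidable; DecidableEquality; Symmetric; Irreflexive)
open import Relation.Binary.Structures using (IsEquivalence)
open import Relation.Binary.PropositionalEquality
open import Relation.Binary.Construct.Closure.ReflexiveTransitive using (Star)

------------------------------------------------------------------------
-- Orbits of an injective self-map of a finite set

Orbit : {A : Set} → (A → A) → Rel A 0ℓ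
Orbit s x y = ∃[ k ] fold x s k ≡ y

module OrbitProperties {A : Set} (s : A → A) (s-injective : Injective _≡_ _≡_ s)
  {N : ℕ} (code : A → Fin N) (code-injective : Injective _≡_ _≡_ code)
  where

  fold-injective : ∀ k → Injective _≡_ _≡_ (λ x → fold x s k)
  fold-injective zero    eq = eq
  fold-injective (suc k) eq = fold-injective k (s-injective eq)

  period : ∀ x → ∃[ p ] 0 < p × fold x s p ≡ x
  period x with Fin.pigeonhole (ℕ.n<1+n N) (λ i → code (fold x s (toℕ i)))
  ... | i , j , i<j , eq = toℕ j ∸ toℕ i , ℕ.m<n⇒0<n∸m i<j ,
    sym (fold-injective (toℕ i) (begin
      fold x s (toℕ i)                                ≡⟨ code-injective eq ⟩
      fold x s (toℕ j)                                ≡⟨ cong (fold x s) (ℕ.m+[n∸m]≡n (ℕ.<⇒≤ i<j)) ⟨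
      fold x s (toℕ i + (toℕ j ∸ toℕ i))              ≡⟨ fold-+ x s (toℕ i) ⟩
      fold (fold x s (toℕ j ∸ toℕ i)) s (toℕ i)       ∎))
    where open ≡-Reasoning

  fold-multiple : ∀ {x p} → fold x s p ≡ x → ∀ q → fold x s (q * p) ≡ x
  fold-multiple             eq zero    = refl
  fold-multiple {x} {p} eq (suc q) =
    trans (fold-+ x s p) (trans (cong (λ y → fold y s p) (fold-multiple eq q)) eq)

  fold-mod : ∀ {x p} .{{_ : NonZero p}} → fold x s p ≡ x →
             ∀ k → fold x s (k % p) ≡ fold x s k
  fold-mod {x} {p} eq k = sym (begin
    fold x s k                                ≡⟨ cong (fold x s) (m≡m%n+[m/n]*n k p) ⟩
    fold x s (k % p + k / p * p)              ≡⟨ fold-+ x s (k % p) ⟩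
    fold (fold x s (k / p * p)) s (k % p)     ≡⟨ cong (λ y → fold y s (k % p)) (fold-multiple eq (k / p)) ⟩
    fold x s (k % p)                          ∎)
    where open ≡-Reasoning

  orbit-refl : ∀ {x} → Orbit s x x
  orbit-refl = 0 , refl

  orbit-trans : ∀ {x y z} → Orbit s x y → Orbit s y z → Orbit s x z
  orbit-trans {x} (k , refl) (l , refl) = l + k , fold-+ x s l

  orbit-sym : ∀ {x y} → Orbit s x y → Orbit s y x
  orbit-sym {x} (k , refl) with period x
  ... | p , 0<p , eq = p ∸ k % p , (begin
    fold (fold x s k) s (p ∸ k % p)         ≡⟨ cong (λ y → fold y s (p ∸ k % p)) (fold-mod eq k) ⟨
    fold (fold x s (k % p)) s (p ∸ k % p)   ≡⟨ fold-+ x s (p ∸ k % p) ⟨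
    fold x s (p ∸ k % p + k % p)            ≡⟨ cong (fold x s) (ℕ.m∸n+n≡m (ℕ.<⇒≤ (m%n<n k p))) ⟩
    fold x s p                              ≡⟨ eq ⟩
    x                                       ∎)
    where
    open ≡-Reasoning
    instance
      p≢0 : NonZero p
      p≢0 = >-nonZero 0<p

  orbit? : DecidableEquality A → Decidable (Orbit s)
  orbit? _≟_ x y with period x
  ... | p , 0<p , eq =
    map′ (λ (i , q) → toℕ i , q)
         (λ (k , q) → fromℕ< (m%n<n k p) ,
            trans (cong (fold x s) (Fin.toℕ-fromℕ< (m%n<n k p))) (trans (fold-mod eq k) q))
         (Fin.any? (λ (i : Fin p) → fold x s (toℕ i) ≟ y))
    where
    instance
      p≢0 : NonZero p
      p≢0 = >-nonZero 0<p

------------------------------------------------------------------------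
-- Finite simple graphs

record Graph : Set₁ where
  field
    order  : ℕ
    Adj    : Rel (Fin order) 0ℓ
    adj?   : Decidable Adj
    symm   : Symmetric Adj
    irrefl : Irreflexive _≡_ Adj

  Vertex : Set
  Vertex = Fin order

  -- A directed edge. The adjacency proof is irrelevant, so a directed edge is
  -- determined by its two ends.
  record Dart : Set where
    eta-equality
    constructor dart
    field
      source    : Vertex
      target    : Vertex
      .adjacent : Adj source target

  open Dart public

  reverse : Dart → Dart
  reverse (dart u v a) = dart v u (symm a)

  darts : List Dart
  darts = concatMap (λ u → concatMap (dartsBetween u) (allFin order)) (allFin order)
    where
    dartsBetween : Vertex → Vertex → List Dart
    dartsBetween u v with adj? u v
    ... | yes a = dart u v a ∷ []
    ... | no  _ = []

  -- Each undirected edge {u , v} is counted through its directed version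
  -- from the smaller to the larger vertex.
  numEdges : ℕ
  numEdges = length (filter (λ e → source e Fin.<? target e) darts)

  degree : Vertex → ℕ
  degree v = length (filter (adj? v) (allFin order))

  Cubic : Set
  Cubic = ∀ v → degree v ≡ 3

  Connected : Set
  Connected = 0 < order × (∀ u v → Star Adj u v)

  _≟ᵈ_ : DecidableEquality Dart
  dart u v _ ≟ᵈ dart u′ v′ _ with u Fin.≟ u′ | v Fin.≟ v′
  ... | yes refl | yes refl = yes refl
  ... | no  u≢u′ | _        = no λ eq → u≢u′ (cong source eq)
  ... | yes _    | no  v≢v′ = no λ eq → v≢v′ (cong target eq)

  dartCode : Dart → Fin (order * order)
  dartCode e = combine (source e) (target e)

  dartCode-injective : Injective _≡_ _≡_ dartCode
  dartCode-injective {dart u v _} {dart u′ v′ _} eq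
    with refl , refl ← Fin.combine-injective u v u′ v′ eq = refl

  -- The edge set is a predicate on directed edges that is meant to hold of
  -- e and of reverse e simultaneously.
  record Subgraph : Set₁ where
    constructor subgraph
    field
      vertices : Pred Vertex 0ℓ
      edges    : Pred Dart 0ℓ

  open Subgraph public

  infixr 7 _∩ˢ_
  infix  4 _≐ˢ_

  _∩ˢ_ : Subgraph → Subgraph → Subgraph
  H ∩ˢ K = subgraph (vertices H ∩ vertices K) (edges H ∩ edges K)

  _≐ˢ_ : Subgraph → Subgraph → Set
  H ≐ˢ K = (vertices H ≐ vertices K) × (edges H ≐ edges K)

  emptySubgraph : Subgraph
  emptySubgraph = subgraph ∅ ∅

  vertexSubgraph : Vertex → Subgraph
  vertexSubgraph v = subgraph ｛ v ｝ ∅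

  edgeSubgraph : Dart → Subgraph
  edgeSubgraph e = subgraph
    (λ v → v ≡ source e ⊎ v ≡ target e)
    (λ d → d ≡ e ⊎ d ≡ reverse e)

------------------------------------------------------------------------
-- Multigraphs, with loops and parallel edges allowed. The undirected edges
-- are the pairs {a , rev a}.

record Multigraph : Set₁ where
  field
    vertexSetoid   : Setoid 0ℓ 0ℓ
    Arc            : Set
    rev            : Arc → Arc
    rev-involutive : ∀ a → rev (rev a) ≡ a
    rev-≢          : ∀ a → rev a ≢ a
    origin         : Arc → Setoid.Carrier vertexSetoid

  open Setoid vertexSetoid using (_≈_)

  NoLoops : Set
  NoLoops = ∀ a → ¬ (origin a ≈ origin (rev a))

  -- Two edges with the same ends can be directed in parallel, which is why
  -- only one way of matching up the ends is considered.
  NoMultipleEdges : Set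
  NoMultipleEdges = ∀ a b → origin a ≈ origin b → origin (rev a) ≈ origin (rev b) →
                    b ≡ a ⊎ b ≡ rev a

  Simple : Set
  Simple = NoLoops × NoMultipleEdges

------------------------------------------------------------------------
-- Embeddings in orientable surfaces

module _ (G : Graph) where
  open Graph G

  record Embedding : Set where
    field
      nx           : Dart → Dart
      nx-injective : Injective _≡_ _≡_ nx
      nx-source    : ∀ e → source (nx e) ≡ source e
      -- The directed edges starting at a vertex form a single cycle of nx.
      nx-cyclic    : ∀ e e′ → source e ≡ source e′ → Orbit nx e e′

    φ : Dart → Dart
    φ e = nx (reverse e)

    φ-injective : Injective _≡_ _≡_ φ
    φ-injective eq = cong reverse (nx-injective eq)

    open OrbitProperties φ φ-injective dartCode dartCode-injective

    -- A face is given by any of its directed edges; see _≈ᶠ_ for equality of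
    -- faces. The one-vertex graph has the trivial face and no directed edges.
    data Face : Set where
      through : Dart → Face
      trivial : order ≡ 1 → Face

    _≈ᶠ_ : Rel Face 0ℓ
    through e ≈ᶠ through e′ = Orbit φ e e′
    through _ ≈ᶠ trivial _  = ⊥
    trivial _ ≈ᶠ through _  = ⊥
    trivial p ≈ᶠ trivial q  = p ≡ q

    _≈ᶠ?_ : Decidable _≈ᶠ_
    through e ≈ᶠ? through e′ = orbit? _≟ᵈ_ e e′
    through _ ≈ᶠ? trivial _  = no λ ()
    trivial _ ≈ᶠ? through _  = no λ ()
    trivial p ≈ᶠ? trivial q  = yes (ℕ.≡-irrelevant p q)

    ≈ᶠ-isEquivalence : IsEquivalence _≈ᶠ_
    ≈ᶠ-isEquivalence = record
      { refl  = λ {F} → rfl F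
      ; sym   = λ {F F′} → sm F F′
      ; trans = λ {F F′ F″} → tr F F′ F″
      }
      where
      rfl : ∀ F → F ≈ᶠ F
      rfl (through e) = orbit-refl
      rfl (trivial p) = refl
      sm : ∀ F F′ → F ≈ᶠ F′ → F′ ≈ᶠ F
      sm (through _) (through _) = orbit-sym
      sm (trivial _) (trivial _) = sym
      tr : ∀ F F′ F″ → F ≈ᶠ F′ → F′ ≈ᶠ F″ → F ≈ᶠ F″
      tr (through _) (through _) (through _) = orbit-trans
      tr (trivial _) (trivial _) (trivial _) = trans

    faceSetoid : Setoid 0ℓ 0ℓ
    faceSetoid = record { isEquivalence = ≈ᶠ-isEquivalence }

    faces : List Face
    faces = deduplicate _≈ᶠ?_ (map through darts ++ trivialFaces)
      where
      trivialFaces : List Face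
      trivialFaces with order ℕ.≟ 1
      ... | yes p = trivial p ∷ []
      ... | no  _ = []

    -- (2 - (v - e + f)) / 2
    genus : ℚ
    genus = (ℤ.+ 2 ℤ.- ((ℤ.+ order ℤ.- ℤ.+ numEdges) ℤ.+ ℤ.+ length faces)) ℚ./ 2

    faceSubgraph : Face → Subgraph
    faceSubgraph (through e) = subgraph
      (λ v → ∃[ d ] Orbit φ e d × source d ≡ v)
      (λ d → Orbit φ e d ⊎ Orbit φ e (reverse d))
    faceSubgraph (trivial _) = subgraph U ∅

    -- The walk e, φ e, …, φⁿ⁻¹ e closes up, has n ≥ 3, and does not repeat a
    -- vertex.
    SimpleCycle : Face → Set
    SimpleCycle (through e) = ∃[ n ] 3 ≤ n × fold e φ n ≡ e ×
      (∀ i j → i < n → j < n → source (fold e φ i) ≡ source (fold e φ j) → i ≡ j)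
    SimpleCycle (trivial _) = ⊥

    Polyhedral : Set
    Polyhedral =
      (∀ F → SimpleCycle F) ×
      (∀ F F′ → ¬ (F ≈ᶠ F′) →
        let I = faceSubgraph F ∩ˢ faceSubgraph F′ in
        I ≐ˢ emptySubgraph
        ⊎ (∃[ v ] I ≐ˢ vertexSubgraph v)
        ⊎ (∃[ e ] I ≐ˢ edgeSubgraph e))

    dual : Multigraph
    dual = record
      { vertexSetoid   = faceSetoid
      ; Arc            = Dart
      ; rev            = reverse
      ; rev-involutive = λ _ → refl
      ; rev-≢          = λ { (dart _ _ a) eq → noLoop (cong source (sym eq)) a }
      ; origin         = through
      }
      where
      noLoop : ∀ {u v} → u ≡ v → .(Adj u v) → ⊥
      noLoop u≡v a = ⊥-elim-irr (irrefl u≡v a)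

  Planar : Set
  Planar = ∃[ E ] Embedding.genus E ≡ 0ℚ

module Submission where

open import Defs
open import Data.Bool.Base using (Bool; true; false; _∧_; _xor_; not)
open import Data.Bool.Properties
  using (xor-same; xor-assoc; xor-comm; xor-identityʳ; ∧-distribˡ-xor; ∧-zeroʳ)
open import Data.Empty using (⊥; ⊥-elim)
open import Data.Empty.Irrelevant using () renaming (⊥-elim to ⊥-elim-irr)
import Data.Fin.Base as Fin
import Data.Fin.Properties as Fin
import Data.Integer.Base as ℤ
open import Data.Integer.GCD using (gcd)
import Data.Integer.Properties as ℤ
open import Data.Integer.Tactic.RingSolver renaming (solve-∀ to ℤ-solve-∀)
open import Data.List.Base
  using (List; []; _∷_; _++_; _ʳ++_; allFin; concatMap; deduplicate; filter; length; lookup; map)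
open import Data.List.Membership.Propositional using (_∈_; find; lose)
open import Data.List.Membership.Propositional.Properties
open import Data.List.Membership.Propositional.Properties.WithK using (unique∧set⇒bag)
open import Data.List.Properties using (filter-all; length-++; ++-identityʳ; length-filter; length-tabulate)
open import Data.List.Relation.Binary.BagAndSetEquality using (∼bag⇒↭)
open import Data.List.Relation.Binary.Permutation.Propositional as Perm using (_↭_)
open import Data.List.Relation.Unary.All as All using (All; []; _∷_)
import Data.List.Relation.Unary.All.Properties as All
open import Data.List.Relation.Unary.AllPairs as AllPairs using (AllPairs; []; _∷_)
import Data.List.Relation.Unary.AllPairs.Properties as AllPairs
open import Data.List.Relation.Unary.Any as Any using (here; there)
import Data.List.Relation.Unary.Any.Properties as Any
import Data.List.Relation.Unary.Unique.DecSetoid.Properties as UniqueDecSetoid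
open import Data.List.Relation.Unary.Unique.Propositional using (Unique)
import Data.List.Relation.Unary.Unique.Propositional.Properties as Unique
open import Data.Nat.Base using (ℕ; zero; suc; _+_; _∸_; _≤_; _<_; z≤n; s≤s; NonZero; >-nonZero)
open import Data.Nat.DivMod using (_%_; m%n<n)
open import Data.Nat.GeneralisedArithmetic using (fold; fold-+)
import Data.Nat.Properties as ℕ
open import Data.Nat.Tactic.RingSolver using (solve-∀)
open import Data.Product.Base using (_×_; _,_; ∃-syntax; proj₁; proj₂)
open import Data.Rational.Base as ℚ using (0ℚ)
import Data.Rational.Properties as ℚ
open import Data.Sum.Base as Sum using (_⊎_; inj₁; inj₂; [_,_]′)
open import Function.Base using (_∘_)
open import Function.Bundles using (mk⇔)
open import Function.Definitions using (Injective)
open import Level using (0ℓ)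
open import Relation.Binary.Bundles using (DecSetoid)
open import Relation.Binary.Construct.Closure.ReflexiveTransitive using (Star; ε; _◅_)
open import Relation.Binary.Core using (Rel)
open import Relation.Binary.Definitions using (Decidable; tri<; tri≈; tri>)
open import Relation.Binary.PropositionalEquality
open import Relation.Binary.Structures using (IsEquivalence)
open import Relation.Nullary using (¬_; Dec; yes; no; does; ¬?; recompute; _×-dec_; _⊎-dec_)
open import Relation.Nullary.Decidable using (dec-true; dec-false; decidable-stable; does-⇔; map′)
open import Relation.Nullary.Negation using (contradiction)
open import Relation.Unary using (Pred; ∁)
open import Relation.Unary.Properties using (∁?)

-- Order the edges of an embedded connected graph, and call an edge primal if it joins two
-- components of the graph of the later edges, and dual if it joins two components of the dual
-- graph of the earlier ones. A parity argument shows that no edge is both, while at least v - 1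
-- edges are primal and f - 1 are dual. Hence v + f ≤ e + 2. In genus 0 equality holds, so every
-- edge is primal or dual; applied to the edge that closes a cycle, this is the Jordan curve theorem.
--
-- Let C be a face of a polyhedral embedding E of a graph with a plane embedding E₀. Walking around
-- C through the neighbouring faces of E shows that all edges off C are joined in the dual of E₀
-- minus C. By the Jordan curve theorem one side of C in E₀ therefore contains no edge off C,
-- so it is a face of E₀ bounded by C or by its reverse. This maps the faces of E₀ injectively
-- to those of E, so E has at least as many faces as E₀ and its genus is 0. A cubic embedding with
-- simple dual is polyhedral, because any two corners at a vertex share an edge.

-- Numbers and lists

-- `i` is the normalised numerator of `i / 2` times the cancelled gcd, and the numerator of `0ℚ` is
-- zero.
/2≡0⇒≡0 : ∀ i → i ℚ./ 2 ≡ 0ℚ → i ≡ ℤ.0ℤ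
/2≡0⇒≡0 i eq = sym (trans (cong (λ q → ℚ.↥ q ℤ.* gcd i (ℤ.+ 2)) (sym eq)) (ℚ.↥-/ i 2))

length-filter-∁ : ∀ {A : Set} {P : Pred A 0ℓ} (P? : ∀ a → Dec (P a)) as →
  length (filter (∁? P?) as) + length (filter P? as) ≡ length as
length-filter-∁ P? []       = refl
length-filter-∁ P? (a ∷ as) with P? a
... | yes _ = trans (ℕ.+-suc _ _) (cong suc (length-filter-∁ P? as))
... | no  _ = cong suc (length-filter-∁ P? as)

fold-shift : ∀ {A : Set} (f : A → A) x k → fold (f x) f k ≡ f (fold x f k)
fold-shift f x zero    = refl
fold-shift f x (suc k) = cong f (fold-shift f x k)

least : ∀ {Q : ℕ → Set} → (∀ n → Dec (Q n)) → ∀ n → Q n → ∃[ m ] Q m × (∀ k → k < m → ¬ Q k)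
least Q? zero    q = 0 , q , λ _ ()
least Q? (suc n) q with Q? 0
... | yes q₀ = 0 , q₀ , λ _ ()
... | no ¬q₀ with m , qₘ , below ← least (Q? ∘ suc) n q =
  suc m , qₘ , λ { zero _ → ¬q₀ ; (suc k) (s≤s k<m) → below k k<m }

separated-lookup : ∀ {A : Set} {R : Rel A 0ℓ} {as} → AllPairs (λ a b → ¬ R a b) as →
  (∀ {a b} → R a b → R b a) → ∀ i j → R (lookup as i) (lookup as j) → i ≡ j
separated-lookup (_ ∷ _)   R-sym Fin.zero    Fin.zero    r = refl
separated-lookup (a≁ ∷ _)  R-sym Fin.zero    (Fin.suc j) r = ⊥-elim (All.lookup a≁ (∈-lookup j) r)
separated-lookup (a≁ ∷ _)  R-sym (Fin.suc i) Fin.zero    r = ⊥-elim (All.lookup a≁ (∈-lookup i) (R-sym r))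
separated-lookup (_ ∷ sep) R-sym (Fin.suc i) (Fin.suc j) r = cong Fin.suc (separated-lookup sep R-sym i j r)

-- Pigeonhole: send each position of `as` to that of a partner in `bs`. A common partner would
-- relate two entries, which separation forbids.
separated-length : ∀ {A B : Set} {R : Rel A 0ℓ} {S : A → B → Set} {as bs} →
  AllPairs (λ a b → ¬ R a b) as → (∀ {a b} → R a b → R b a) →
  (∀ {a a′ b} → S a b → S a′ b → R a a′) → (∀ {a} → a ∈ as → Any.Any (S a) bs) → length as ≤ length bs
separated-length {S = S} {as} {bs} sep R-sym S-injective S-total = Fin.injective⇒≤ {f = position} λ {i} {j} eq →
  separated-lookup sep R-sym i j (S-injective (Any.lookup-index (member i))
    (subst (λ k → S (lookup as j) (lookup bs k)) (sym eq) (Any.lookup-index (member j))))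
  where
  member : ∀ i → Any.Any (S (lookup as i)) bs
  member i = S-total (∈-lookup i)
  position : Fin.Fin (length as) → Fin.Fin (length bs)
  position i = Any.index (member i)

-- Connectivity by a list of edges

module Connectivity {A X : Set} (_≈_ : Rel A 0ℓ) (_≈?_ : Decidable _≈_)
  (≈-isEquivalence : IsEquivalence _≈_) (s t : X → A) where

  open IsEquivalence ≈-isEquivalence
    renaming (refl to ≈-refl; sym to ≈-sym; trans to ≈-trans)

  -- A path can be shortened to cross `x` at most once, in one of its two directions. This form
  -- makes connectedness decidable by recursion on the list.
  Conn : List X → Rel A 0ℓ
  Conn []      a b = a ≈ b
  Conn (x ∷ L) a b =
    Conn L a b ⊎ (Conn L a (s x) × Conn L (t x) b) ⊎ (Conn L a (t x) × Conn L (s x) b)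

  conn? : ∀ L → Decidable (Conn L)
  conn? []      a b = a ≈? b
  conn? (x ∷ L) a b = conn? L a b
    ⊎-dec ((conn? L a (s x) ×-dec conn? L (t x) b) ⊎-dec (conn? L a (t x) ×-dec conn? L (s x) b))

  conn-base : ∀ L {a b} → a ≈ b → Conn L a b
  conn-base []      p = p
  conn-base (x ∷ L) p = inj₁ (conn-base L p)

  conn-refl : ∀ L {a} → Conn L a a
  conn-refl L = conn-base L ≈-refl

  conn-sym : ∀ L {a b} → Conn L a b → Conn L b a
  conn-sym []      p = ≈-sym p
  conn-sym (x ∷ L) (inj₁ p)              = inj₁ (conn-sym L p)
  conn-sym (x ∷ L) (inj₂ (inj₁ (p , q))) = inj₂ (inj₂ (conn-sym L q , conn-sym L p))
  conn-sym (x ∷ L) (inj₂ (inj₂ (p , q))) = inj₂ (inj₁ (conn-sym L q , conn-sym L p))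

  conn-trans : ∀ L {a b c} → Conn L a b → Conn L b c → Conn L a c
  conn-trans []      p q = ≈-trans p q
  conn-trans (x ∷ L) (inj₁ p) (inj₁ q) = inj₁ (conn-trans L p q)
  conn-trans (x ∷ L) (inj₁ p) (inj₂ (inj₁ (q , r))) = inj₂ (inj₁ (conn-trans L p q , r))
  conn-trans (x ∷ L) (inj₁ p) (inj₂ (inj₂ (q , r))) = inj₂ (inj₂ (conn-trans L p q , r))
  conn-trans (x ∷ L) (inj₂ (inj₁ (p , q))) (inj₁ r) = inj₂ (inj₁ (p , conn-trans L q r))
  conn-trans (x ∷ L) (inj₂ (inj₂ (p , q))) (inj₁ r) = inj₂ (inj₂ (p , conn-trans L q r))
  conn-trans (x ∷ L) (inj₂ (inj₁ (p , _))) (inj₂ (inj₁ (_ , r))) = inj₂ (inj₁ (p , r))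
  conn-trans (x ∷ L) (inj₂ (inj₁ (p , _))) (inj₂ (inj₂ (_ , r))) = inj₁ (conn-trans L p r)
  conn-trans (x ∷ L) (inj₂ (inj₂ (p , _))) (inj₂ (inj₁ (_ , r))) = inj₁ (conn-trans L p r)
  conn-trans (x ∷ L) (inj₂ (inj₂ (p , _))) (inj₂ (inj₂ (_ , r))) = inj₂ (inj₂ (p , r))

  conn-edge : ∀ {L x} → x ∈ L → Conn L (s x) (t x)
  conn-edge {_ ∷ L} (here refl) = inj₂ (inj₁ (conn-refl L , conn-refl L))
  conn-edge {_ ∷ L} (there x∈L) = inj₁ (conn-edge x∈L)

  conn-contract : ∀ {L x} → Conn L (s x) (t x) → ∀ {a b} → Conn (x ∷ L) a b → Conn L a b
  conn-contract {L} p (inj₁ q)              = q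
  conn-contract {L} p (inj₂ (inj₁ (q , r))) = conn-trans L q (conn-trans L p r)
  conn-contract {L} p (inj₂ (inj₂ (q , r))) = conn-trans L q (conn-trans L (conn-sym L p) r)

  -- The size of the spanning forest built greedily from the end of the list, that is, the rank of
  -- the graphic matroid.
  rank : List X → ℕ
  rank []      = 0
  rank (x ∷ L) with conn? L (s x) (t x)
  ... | yes _ = rank L
  ... | no  _ = suc (rank L)

  rank-∷-connected : ∀ {L x} → Conn L (s x) (t x) → rank (x ∷ L) ≡ rank L
  rank-∷-connected {L} {x} p with conn? L (s x) (t x)
  ... | yes _ = refl
  ... | no ¬p = ⊥-elim (¬p p)

  rank-∷-≤ : ∀ L x → rank (x ∷ L) ≤ suc (rank L)
  rank-∷-≤ L x with conn? L (s x) (t x)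
  ... | yes _ = ℕ.n≤1+n _
  ... | no  _ = ℕ.≤-refl

  Separated : List X → List A → Set
  Separated L = AllPairs (λ a b → ¬ Conn L a b)

  -- A separated list meets each class at most once.
  drop-class : ∀ L c {as} → Separated L as →
               length as ≤ suc (length (filter (λ a → ¬? (conn? L c a)) as))
  drop-class L c []            = z≤n
  drop-class L c {a ∷ as} (a≁ ∷ sep) with conn? L c a
  ... | no  _ = s≤s (drop-class L c sep)
  ... | yes p = s≤s (ℕ.≤-reflexive (cong length (sym (filter-all _
          (All.map (λ a≁b q → a≁b (conn-trans L (conn-sym L p) q)) a≁)))))

  -- A new connection runs through `x`, so one of its two ends lies in the class of `s x`, which has
  -- no representative left.
  separated-∷ : ∀ L x {as} → Separated L as → All (λ a → ¬ Conn L (s x) a) as → Separated (x ∷ L) as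
  separated-∷ L x []           []       = []
  separated-∷ L x (a≁ ∷ sep) (p ∷ ps) =
    All.zipWith (λ { (a≁b , q) (inj₁ r)              → a≁b r
                   ; (a≁b , q) (inj₂ (inj₁ (r , _))) → p (conn-sym L r)
                   ; (a≁b , q) (inj₂ (inj₂ (_ , r))) → q r }) (a≁ , ps)
    ∷ separated-∷ L x sep ps

  -- Each edge that raises the rank merges two classes and costs at most one representative.
  separate : ∀ L {as} → Separated [] as →
             ∃[ bs ] Separated L bs × length as ≤ rank L + length bs
  separate []      {as} sep = as , sep , ℕ.≤-refl
  separate (x ∷ L) sep with separate L sep | conn? L (s x) (t x)
  ... | bs , sep′ , le | yes p =
    bs , AllPairs.map (λ a≁b q → a≁b (conn-contract {L} {x} p q)) sep′ , le
  ... | bs , sep′ , le | no _  =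
      filter Q? bs
    , separated-∷ L x (AllPairs.filter⁺ Q? sep′) (All.all-filter Q? bs)
    , ℕ.≤-trans le (ℕ.≤-trans (ℕ.+-monoʳ-≤ (rank L) (drop-class L (s x) sep′))
                              (ℕ.≤-reflexive (ℕ.+-suc (rank L) _)))
    where Q? = λ a → ¬? (conn? L (s x) a)

  connected⇒≤rank : ∀ L {as} → Separated [] as → (∀ a b → Conn L a b) → length as ≤ suc (rank L)
  connected⇒≤rank L sep conn with separate L sep
  ... | []        , _ , le = ℕ.≤-trans le (ℕ.≤-trans (ℕ.≤-reflexive (ℕ.+-identityʳ _)) (ℕ.n≤1+n _))
  ... | _ ∷ []    , _ , le = ℕ.≤-trans le (ℕ.≤-reflexive (ℕ.+-comm _ 1))
  ... | a ∷ b ∷ _ , ((a≁b ∷ _) ∷ _) , _ = ⊥-elim (a≁b (conn a b))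

-- Sums modulo 2

parity : {A : Set} → (A → Bool) → List A → Bool
parity f []       = false
parity f (a ∷ as) = f a xor parity f as

module _ {A : Set} where

  parity-cong : ∀ {f g : A → Bool} → (∀ a → f a ≡ g a) → ∀ as → parity f as ≡ parity g as
  parity-cong f≗g []       = refl
  parity-cong f≗g (a ∷ as) = cong₂ _xor_ (f≗g a) (parity-cong f≗g as)

  parity-xor : ∀ (f g : A → Bool) as → parity (λ a → f a xor g a) as ≡ parity f as xor parity g as
  parity-xor f g []       = refl
  parity-xor f g (a ∷ as) = trans (cong ((f a xor g a) xor_) (parity-xor f g as))
    (interchange (f a) (g a) (parity f as) (parity g as))
    where
    interchange : ∀ w x y z → (w xor x) xor (y xor z) ≡ (w xor y) xor (x xor z)
    interchange w x y z = begin
      (w xor x) xor (y xor z)  ≡⟨ xor-assoc w x (y xor z) ⟩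
      w xor (x xor (y xor z))  ≡⟨ cong (w xor_) (xor-assoc x y z) ⟨
      w xor ((x xor y) xor z)  ≡⟨ cong (λ u → w xor (u xor z)) (xor-comm x y) ⟩
      w xor ((y xor x) xor z)  ≡⟨ cong (w xor_) (xor-assoc y x z) ⟩
      w xor (y xor (x xor z))  ≡⟨ xor-assoc w y (x xor z) ⟨
      (w xor y) xor (x xor z)  ∎
      where open ≡-Reasoning

  parity-↭ : ∀ (f : A → Bool) {as bs} → as ↭ bs → parity f as ≡ parity f bs
  parity-↭ f Perm.refl         = refl
  parity-↭ f (Perm.prep a p)   = cong (f a xor_) (parity-↭ f p)
  parity-↭ f (Perm.swap {as} {bs} a b p) = begin
    f a xor (f b xor parity f as)  ≡⟨ xor-assoc (f a) (f b) _ ⟨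
    (f a xor f b) xor parity f as  ≡⟨ cong₂ _xor_ (xor-comm (f a) (f b)) (parity-↭ f p) ⟩
    (f b xor f a) xor parity f bs  ≡⟨ xor-assoc (f b) (f a) _ ⟩
    f b xor (f a xor parity f bs)  ∎
    where open ≡-Reasoning
  parity-↭ f (Perm.trans p q)  = trans (parity-↭ f p) (parity-↭ f q)

  parity-map : ∀ (f : A → Bool) (σ : A → A) as → parity f (map σ as) ≡ parity (f ∘ σ) as
  parity-map f σ []       = refl
  parity-map f σ (a ∷ as) = cong (f (σ a) xor_) (parity-map f σ as)

  -- Both `as` and its image are duplicate-free and contain every element, so they are permutations
  -- of each other.
  parity-permute : ∀ (f : A → Bool) (σ : A → A) {as} → Unique as → (∀ a → a ∈ as) →
    Injective _≡_ _≡_ σ → (∀ b → ∃[ a ] σ a ≡ b) → parity (f ∘ σ) as ≡ parity f as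
  parity-permute f σ {as} uniq all inj surj = trans (sym (parity-map f σ as))
    (parity-↭ f (∼bag⇒↭ (unique∧set⇒bag (Unique.map⁺ inj uniq) uniq (mk⇔ (λ _ → all _) onto))))
    where
    onto : ∀ {b} → b ∈ as → b ∈ map σ as
    onto {b} _ with a , eq ← surj b = subst (_∈ map σ as) eq (∈-map⁺ σ (all a))

  parity-false : ∀ {f : A → Bool} {as} → All (λ a → f a ≡ false) as → parity f as ≡ false
  parity-false []       = refl
  parity-false (p ∷ ps) = cong₂ _xor_ p (parity-false ps)

  parity-single : ∀ {f : A → Bool} {as x} → Unique as → x ∈ as → f x ≡ true →
    (∀ a → a ≢ x → f a ≡ false) → parity f as ≡ true
  parity-single (x≢ ∷ _) (here refl) fx f≢ =
    cong₂ _xor_ fx (parity-false (All.map (λ x≢a → f≢ _ (x≢a ∘ sym)) x≢))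
  parity-single (a≢ ∷ uniq) (there x∈) fx f≢ =
    cong₂ _xor_ (f≢ _ (All.lookup a≢ x∈)) (parity-single uniq x∈ fx f≢)

-- Darts and oriented edges

module GraphProperties (G : Graph) where
  open Graph G

  -- Graph.darts hides its local function; unification recovers it.
  mutual
    dartsBetween : Vertex → Vertex → List Dart
    dartsBetween = _

    darts-unfold : darts ≡ concatMap (λ u → concatMap (dartsBetween u) (allFin order)) (allFin order)
    darts-unfold = refl

  ∈-dartsBetween : ∀ {u v} .(a : Adj u v) → dart u v a ∈ dartsBetween u v
  ∈-dartsBetween {u} {v} a with adj? u v
  ... | yes _ = here refl
  ... | no ¬a = ⊥-elim-irr (¬a a)

  ∈-darts : ∀ d → d ∈ darts
  ∈-darts (dart u v a) = ∈-concatMap⁺ _ (Any.map (λ { refl →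
    ∈-concatMap⁺ _ (Any.map (λ { refl → ∈-dartsBetween a }) (∈-allFin v)) }) (∈-allFin u))

  source≢target : ∀ d → source d ≢ target d
  source≢target (dart u v a) u≡v = ⊥-elim-irr (irrefl u≡v a)

  -- Its length is `numEdges` by definition, which the Euler count uses.
  edgeList : List Dart
  edgeList = filter (λ e → source e Fin.<? target e) darts

  ∈-edgeList : ∀ {d} → source d Fin.< target d → d ∈ edgeList
  ∈-edgeList {d} = ∈-filter⁺ (λ e → source e Fin.<? target e) (∈-darts d)

  edgeList-oriented : ∀ {d} → d ∈ edgeList → source d Fin.< target d
  edgeList-oriented d∈ = proj₂ (∈-filter⁻ (λ e → source e Fin.<? target e) {xs = darts} d∈)

  orient : ∀ d → d ∈ edgeList ⊎ reverse d ∈ edgeList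
  orient d with Fin.<-cmp (source d) (target d)
  ... | tri< s<t _ _ = inj₁ (∈-edgeList s<t)
  ... | tri≈ _ s≡t _ = ⊥-elim (source≢target d s≡t)
  ... | tri> _ _ t<s = inj₂ (∈-edgeList t<s)

  open import Data.List.Relation.Unary.Unique.DecPropositional.Properties _≟ᵈ_ using (deduplicate-!)

  uniqueDarts : List Dart
  uniqueDarts = deduplicate _≟ᵈ_ darts

  uniqueDarts-unique : Unique uniqueDarts
  uniqueDarts-unique = deduplicate-! darts

  ∈-uniqueDarts : ∀ d → d ∈ uniqueDarts
  ∈-uniqueDarts d = ∈-deduplicate⁺ _≟ᵈ_ (∈-darts d)

-- Euler's inequality

module EmbeddingProperties {G : Graph} (E : Embedding G) where
  open Graph G
  open GraphProperties G
  open Embedding E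
  open OrbitProperties φ φ-injective dartCode dartCode-injective public

  module V = Connectivity _≡_ Fin._≟_ isEquivalence source target
  -- This is connectivity in the dual graph: an edge joins the faces on its two sides.
  module F = Connectivity _≈ᶠ_ _≈ᶠ?_ ≈ᶠ-isEquivalence through (through ∘ reverse)

  φ-source : ∀ d → source (φ d) ≡ target d
  φ-source d = nx-source (reverse d)

  infix 4 _≋_
  _≋_ : Rel Dart 0ℓ
  _≋_ = Orbit φ

  φ-step : ∀ {d e} → d ≋ e → d ≋ φ e
  φ-step (k , eq) = suc k , cong φ eq

  φ-unstep : ∀ {d e} → d ≋ φ e → d ≋ e
  φ-unstep p = orbit-trans p (orbit-sym (1 , refl))

  nx-surjective : ∀ d → ∃[ e ] nx e ≡ d
  nx-surjective d with nx-cyclic (nx d) d (nx-source d)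
  ... | k , eq = fold d nx k , trans (sym (fold-shift nx d k)) eq

  Connects : List Dart → Dart → Set
  Connects L x = V.Conn L (source x) (target x)

  Joins : List Dart → Dart → Set
  Joins L x = F.Conn L (through x) (through (reverse x))

  φ-conn : ∀ L d → F.Conn L (through d) (through (φ d))
  φ-conn L d = F.conn-base L (1 , refl)

  -- Suppose that neither holds. Let s be the indicator of the darts whose face is
  -- joined by L₁ to that of x, and p that of the darts whose source is connected by
  -- L₂ to that of x. The sum of p d (s d + s (reverse d)) over all darts d is
  -- even since s (reverse d) = s (nx d), and it is odd since, up to pairs
  -- d, reverse d, only x contributes.
  bridge : ∀ {L₁ x L₂} → x ∈ edgeList → (∀ {d} → d ∈ edgeList → d ∈ L₁ ⊎ d ∈ x ∷ L₂) →
           ¬ Connects L₂ x → ¬ Joins L₁ x → ⊥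
  bridge {L₁} {x} {L₂} x∈ cover ¬connects ¬joins = true≢false (trans (sym odd) even)
    where
    open ≡-Reasoning
    s? = λ d → F.conn? L₁ (through x) (through d)
    p? = λ d → V.conn? L₂ (source x) (source d)
    o? = λ d → source d Fin.<? target d

    s p o b h k g g′ : Dart → Bool
    s d = does (s? d)
    p d = does (p? d)
    o d = does (o? d)
    b d = s d xor s (reverse d)
    h d = p d ∧ b d
    k d = p d ∧ s d
    g d = o d ∧ (p d ∧ b d)
    g′ d = o d ∧ (p (reverse d) ∧ b d)

    true≢false : true ≢ false
    true≢false ()

    s-reverse : ∀ d → s (reverse d) ≡ s (nx d)
    s-reverse d = does-⇔ (mk⇔
      (λ c → F.conn-trans L₁ c (φ-conn L₁ (reverse d)))
      (λ c → F.conn-trans L₁ c (F.conn-sym L₁ (φ-conn L₁ (reverse d)))))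
      (s? (reverse d)) (s? (nx d))

    p-nx : ∀ d → p d ≡ p (nx d)
    p-nx d = cong (λ u → does (V.conn? L₂ (source x) u)) (sym (nx-source d))

    h-vertex : ∀ d → h d ≡ k d xor k (nx d)
    h-vertex d = trans (∧-distribˡ-xor (p d) (s d) (s (reverse d)))
      (cong (k d xor_) (cong₂ _∧_ (p-nx d) (s-reverse d)))

    even : parity h uniqueDarts ≡ false
    even = begin
      parity h uniqueDarts                                     ≡⟨ parity-cong h-vertex uniqueDarts ⟩
      parity (λ d → k d xor k (nx d)) uniqueDarts              ≡⟨ parity-xor k (k ∘ nx) uniqueDarts ⟩
      parity k uniqueDarts xor parity (k ∘ nx) uniqueDarts     ≡⟨ cong (parity k uniqueDarts xor_)
        (parity-permute k nx uniqueDarts-unique ∈-uniqueDarts nx-injective nx-surjective) ⟩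
      parity k uniqueDarts xor parity k uniqueDarts            ≡⟨ xor-same (parity k uniqueDarts) ⟩
      false                                                    ∎

    o-reverse : ∀ d → o (reverse d) ≡ not (o d)
    o-reverse d with Fin.<-cmp (source d) (target d)
    ... | tri< s<t _ ¬t<s = trans (dec-false (o? (reverse d)) ¬t<s) (cong not (sym (dec-true (o? d) s<t)))
    ... | tri≈ _ s≡t _    = ⊥-elim (source≢target d s≡t)
    ... | tri> ¬s<t _ t<s = trans (dec-true (o? (reverse d)) t<s) (cong not (sym (dec-false (o? d) ¬s<t)))

    split : ∀ c u v → u ≡ v → u ≡ (c ∧ u) xor (not c ∧ v)
    split true  u v eq = sym (xor-identityʳ u)
    split false u v eq = eq

    -- Each term is charged to the increasing orientation of its edge: `g` collects what comes from
    -- that dart and `g′` what comes from its reverse. Reindexing by `reverse` then leaves only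
    -- increasing darts to inspect.
    h-edge : ∀ d → h d ≡ g d xor g′ (reverse d)
    h-edge d = trans
      (split (o d) (h d) (p d ∧ b (reverse d)) (cong (p d ∧_) (xor-comm (s d) (s (reverse d)))))
      (cong (λ c → g d xor (c ∧ (p d ∧ b (reverse d)))) (sym (o-reverse d)))

    at-x : g x xor g′ x ≡ true
    at-x = cong₂ _xor_ (cong₂ _∧_ ox (cong₂ _∧_ px bx)) (cong₂ _∧_ ox (cong₂ _∧_ px′ bx))
      where
      ox : o x ≡ true
      ox = dec-true (o? x) (edgeList-oriented x∈)
      px : p x ≡ true
      px = dec-true (p? x) (V.conn-refl L₂)
      px′ : p (reverse x) ≡ false
      px′ = dec-false (p? (reverse x)) ¬connects
      bx : b x ≡ true
      bx = cong₂ _xor_ (dec-true (s? x) (F.conn-refl L₁ {through x})) (dec-false (s? (reverse x)) ¬joins)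

    false-unless : ∀ {c u v} → (c ≡ true → u xor v ≡ false) → (c ∧ u) xor (c ∧ v) ≡ false
    false-unless {true}  eq = eq refl
    false-unless {false} eq = refl

    off-x : ∀ d → d ≢ x → g d xor g′ d ≡ false
    off-x d d≢x = false-unless λ od → inner (cover (∈-edgeList (from-does (o? d) od)))
      where
      from-does : ∀ {P : Set} (P? : Dec P) → does P? ≡ true → P
      from-does (yes q) _ = q
      inner : d ∈ L₁ ⊎ d ∈ x ∷ L₂ → (p d ∧ b d) xor (p (reverse d) ∧ b d) ≡ false
      -- An edge of `L₁` has both sides in one class of faces, so `b` vanishes. An edge of `L₂` has
      -- both ends in one class of vertices, so its two contributions cancel.
      inner (inj₁ d∈L₁) = cong₂ _xor_ (trans (cong (p d ∧_) bd) (∧-zeroʳ _))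
                                      (trans (cong (p (reverse d) ∧_) bd) (∧-zeroʳ _))
        where
        bd : b d ≡ false
        bd = trans (cong (s d xor_) (sym (does-⇔ (mk⇔
          (λ c → F.conn-trans L₁ c (F.conn-edge d∈L₁))
          (λ c → F.conn-trans L₁ c (F.conn-sym L₁ (F.conn-edge d∈L₁))))
          (s? d) (s? (reverse d))))) (xor-same (s d))
      inner (inj₂ (here d≡x))   = ⊥-elim (d≢x d≡x)
      inner (inj₂ (there d∈L₂)) = trans (cong (λ q → (p d ∧ b d) xor (q ∧ b d)) (sym pd)) (xor-same (h d))
        where
        pd : p d ≡ p (reverse d)
        pd = does-⇔ (mk⇔
          (λ c → V.conn-trans L₂ c (V.conn-edge d∈L₂))
          (λ c → V.conn-trans L₂ c (V.conn-sym L₂ (V.conn-edge d∈L₂))))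
          (p? d) (p? (reverse d))

    odd : parity h uniqueDarts ≡ true
    odd = begin
      parity h uniqueDarts                                      ≡⟨ parity-cong h-edge uniqueDarts ⟩
      parity (λ d → g d xor g′ (reverse d)) uniqueDarts         ≡⟨ parity-xor g (g′ ∘ reverse) uniqueDarts ⟩
      parity g uniqueDarts xor parity (g′ ∘ reverse) uniqueDarts ≡⟨ cong (parity g uniqueDarts xor_)
        (parity-permute g′ reverse uniqueDarts-unique ∈-uniqueDarts (cong reverse) (λ d → reverse d , refl)) ⟩
      parity g uniqueDarts xor parity g′ uniqueDarts            ≡⟨ parity-xor g g′ uniqueDarts ⟨
      parity (λ d → g d xor g′ d) uniqueDarts                   ≡⟨ parity-single uniqueDarts-unique (∈-uniqueDarts x) at-x off-x ⟩
      true                                                      ∎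

  -- Prepending A to the primal list and moving it to the dual list, each edge of A raises
  -- only one of the two ranks.
  rank-segment : ∀ A B L → All (_∈ edgeList) A → (∀ {d} → d ∈ edgeList → d ∈ L ⊎ d ∈ A ++ B) →
    V.rank (A ++ B) + F.rank (A ʳ++ L) ≤ length A + (V.rank B + F.rank L)
  rank-segment []      B L _           cover = ℕ.≤-refl
  rank-segment (x ∷ A) B L (x∈ ∷ A⊆) cover = by-cases
    (V.conn? (A ++ B) (source x) (target x)) (F.conn? L (through x) (through (reverse x)))
    where
    open ℕ.≤-Reasoning
    IH : V.rank (A ++ B) + F.rank (A ʳ++ x ∷ L) ≤ length A + (V.rank B + F.rank (x ∷ L))
    IH = rank-segment A B (x ∷ L) A⊆ λ d∈ → shift (cover d∈)
      where
      shift : ∀ {d} → d ∈ L ⊎ d ∈ x ∷ A ++ B → d ∈ x ∷ L ⊎ d ∈ A ++ B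
      shift (inj₁ d∈L)          = inj₁ (there d∈L)
      shift (inj₂ (here d≡x))   = inj₁ (here d≡x)
      shift (inj₂ (there d∈AB)) = inj₂ d∈AB
    by-cases : Dec (Connects (A ++ B) x) → Dec (Joins L x) →
      V.rank (x ∷ A ++ B) + F.rank (A ʳ++ x ∷ L) ≤ suc (length A + (V.rank B + F.rank L))
    by-cases (no ¬c) (no ¬j) = ⊥-elim (bridge x∈ cover ¬c ¬j)
    by-cases (yes c) _       = begin
      V.rank (x ∷ A ++ B) + F.rank (A ʳ++ x ∷ L) ≡⟨ cong (_+ F.rank (A ʳ++ x ∷ L)) (V.rank-∷-connected {A ++ B} {x} c) ⟩
      V.rank (A ++ B) + F.rank (A ʳ++ x ∷ L)     ≤⟨ IH ⟩
      length A + (V.rank B + F.rank (x ∷ L))     ≤⟨ ℕ.+-monoʳ-≤ (length A) (ℕ.+-monoʳ-≤ (V.rank B) (F.rank-∷-≤ L x)) ⟩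
      length A + (V.rank B + suc (F.rank L))     ≡⟨ cong (length A +_) (ℕ.+-suc (V.rank B) (F.rank L)) ⟩
      length A + suc (V.rank B + F.rank L)       ≡⟨ ℕ.+-suc (length A) _ ⟩
      suc (length A + (V.rank B + F.rank L))     ∎
    by-cases (no _) (yes j)  = begin
      V.rank (x ∷ A ++ B) + F.rank (A ʳ++ x ∷ L)   ≤⟨ ℕ.+-monoˡ-≤ (F.rank (A ʳ++ x ∷ L)) (V.rank-∷-≤ (A ++ B) x) ⟩
      suc (V.rank (A ++ B) + F.rank (A ʳ++ x ∷ L)) ≤⟨ s≤s IH ⟩
      suc (length A + (V.rank B + F.rank (x ∷ L))) ≡⟨ cong (λ r → suc (length A + (V.rank B + r))) (F.rank-∷-connected {L} {x} j) ⟩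
      suc (length A + (V.rank B + F.rank L))       ∎

  module _ (connected : Connected) (order≢1 : order ≢ 1) {L : List Dart}
    (spans : ∀ {d} → d ∈ edgeList → d ∈ L) where

    private
      spanning-edge : ∀ d → V.Conn L (source d) (target d)
      spanning-edge d with orient d
      ... | inj₁ d∈ = V.conn-edge (spans d∈)
      ... | inj₂ d∈ = V.conn-sym L (V.conn-edge (spans d∈))

      spanning-reverse : ∀ d → F.Conn L (through d) (through (reverse d))
      spanning-reverse d with orient d
      ... | inj₁ d∈ = F.conn-edge (spans d∈)
      ... | inj₂ d∈ = F.conn-sym L (F.conn-edge (spans d∈))

    spanning-vertices : ∀ u v → V.Conn L u v
    spanning-vertices u v = along (proj₂ connected u v)
      where
      along : ∀ {u} → Star Adj u v → V.Conn L u v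
      along ε       = V.conn-refl L
      along (a ◅ w) = V.conn-trans L (spanning-edge (dart _ _ a)) (along w)

    -- The dual of a connected graph is connected: follow a walk in the graph, and at each vertex
    -- rotate to the next dart of the walk. Every rotation step crosses one edge.
    spanning-darts : ∀ d e → F.Conn L (through d) (through e)
    spanning-darts d e = along (proj₂ connected (source d) (source e)) d refl
      where
      nx-step : ∀ d → F.Conn L (through d) (through (nx d))
      nx-step d = F.conn-trans L (spanning-reverse d) (φ-conn L (reverse d))
      nx-steps : ∀ k d → F.Conn L (through d) (through (fold d nx k))
      nx-steps zero    d = F.conn-refl L
      nx-steps (suc k) d = F.conn-trans L (nx-steps k d) (nx-step _)
      around : ∀ d e → source d ≡ source e → F.Conn L (through d) (through e)
      around d e eq with nx-cyclic d e eq
      ... | k , refl = nx-steps k d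
      along : ∀ {u} → Star Adj u (source e) → ∀ d → source d ≡ u → F.Conn L (through d) (through e)
      along ε       d refl = around d e refl
      along (a ◅ w) d refl = F.conn-trans L (around d (dart _ _ a) refl)
        (F.conn-trans L (spanning-reverse (dart _ _ a)) (along w (reverse (dart _ _ a)) refl))

    spanning-faces : ∀ F F′ → F.Conn L F F′
    spanning-faces (through d) (through e) = spanning-darts d e
    spanning-faces (trivial p) _           = ⊥-elim (order≢1 p)
    spanning-faces _           (trivial p) = ⊥-elim (order≢1 p)

module EulerFormula {G : Graph} (E : Embedding G) where
  open Graph G
  open GraphProperties G
  open Embedding E
  open EmbeddingProperties E

  faceDecSetoid : DecSetoid 0ℓ 0ℓ
  faceDecSetoid = record { isDecEquivalence = record { isEquivalence = ≈ᶠ-isEquivalence ; _≟_ = _≈ᶠ?_ } }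

  faces-separated : F.Separated [] faces
  faces-separated = UniqueDecSetoid.deduplicate-! faceDecSetoid _

  genus-0 : genus ≡ 0ℚ → order + length faces ≡ 2 + numEdges
  genus-0 eq = ℤ.+-injective (begin
    ℤ.+ v ℤ.+ ℤ.+ f              ≡⟨ rearrange (ℤ.+ v) (ℤ.+ f) (ℤ.+ e) ⟩
    (ℤ.+ 2 ℤ.+ ℤ.+ e) ℤ.- twiceGenus
                                 ≡⟨ cong (λ z → (ℤ.+ 2 ℤ.+ ℤ.+ e) ℤ.- z) (/2≡0⇒≡0 twiceGenus eq) ⟩
    (ℤ.+ 2 ℤ.+ ℤ.+ e) ℤ.- ℤ.0ℤ   ≡⟨ ℤ.+-identityʳ _ ⟩
    ℤ.+ 2 ℤ.+ ℤ.+ e              ∎)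
    where
    open ≡-Reasoning
    v = order
    f = length faces
    e = numEdges
    twiceGenus = ℤ.+ 2 ℤ.- ((ℤ.+ v ℤ.- ℤ.+ e) ℤ.+ ℤ.+ f)
    rearrange : ∀ v f e → v ℤ.+ f ≡ (ℤ.+ 2 ℤ.+ e) ℤ.- (ℤ.+ 2 ℤ.- ((v ℤ.- e) ℤ.+ f))
    rearrange = ℤ-solve-∀

  private
    ∈-ʳ++ : ∀ {d : Dart} A {L} → d ∈ L ⊎ d ∈ A → d ∈ A ʳ++ L
    ∈-ʳ++ A {L} = Any.reverseAcc⁺ L A

    order≡ : length (allFin order) ≡ order
    order≡ = length-tabulate _

  module _ (connected : Connected) (order≢1 : order ≢ 1) where

    order≤rank : ∀ {L} → (∀ {d} → d ∈ edgeList → d ∈ L) → order ≤ suc (V.rank L)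
    order≤rank {L} spans = ℕ.≤-trans (ℕ.≤-reflexive (sym order≡))
      (V.connected⇒≤rank L (Unique.allFin⁺ order) (spanning-vertices connected order≢1 spans))

    faces≤rank : ∀ {L} → (∀ {d} → d ∈ edgeList → d ∈ L) → length faces ≤ suc (F.rank L)
    faces≤rank {L} spans = F.connected⇒≤rank L faces-separated (spanning-faces connected order≢1 spans)

    -- The primal rank compares each edge with the later ones. The dual rank is taken of the
    -- reversed list and so compares it with the earlier ones. Both ranks start from zero.
    euler-≤ : order + length faces ≤ 2 + numEdges
    euler-≤ = begin
      order + length faces
        ≤⟨ ℕ.+-mono-≤ (order≤rank (λ d∈ → ∈-++⁺ˡ d∈)) (faces≤rank (λ d∈ → ∈-ʳ++ edgeList (inj₂ d∈))) ⟩
      suc (V.rank (edgeList ++ [])) + suc (F.rank (edgeList ʳ++ []))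
        ≡⟨ cong suc (ℕ.+-suc _ _) ⟩
      2 + (V.rank (edgeList ++ []) + F.rank (edgeList ʳ++ []))
        ≤⟨ ℕ.+-monoʳ-≤ 2 (rank-segment edgeList [] [] (All.tabulate (λ d∈ → d∈)) (λ d∈ → inj₂ (∈-++⁺ˡ d∈))) ⟩
      2 + (numEdges + 0)
        ≡⟨ cong (2 +_) (ℕ.+-identityʳ numEdges) ⟩
      2 + numEdges ∎
      where open ℕ.≤-Reasoning

    -- An edge x that raises neither rank makes the Euler bound strict.
    euler-< : ∀ A x B → All (_∈ edgeList) A → All (_∈ edgeList) B →
      (∀ {d} → d ∈ edgeList → d ∈ A ++ x ∷ B) → Connects B x → Joins (A ʳ++ []) x →
      order + length faces ≤ 2 + (length A + length B)
    euler-< A x B A⊆ B⊆ cover connects joins = begin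
      order + length faces      ≤⟨ ℕ.+-mono-≤ (order≤rank cover) (faces≤rank spans) ⟩
      suc rV + suc rF           ≡⟨ cong suc (ℕ.+-suc rV rF) ⟩
      2 + (rV + rF)             ≤⟨ ℕ.+-monoʳ-≤ 2 (ℕ.+-cancelʳ-≤ (fA + vB) _ _ total) ⟩
      2 + (length A + length B) ∎
      where
      open ℕ.≤-Reasoning
      A′ = A ʳ++ []
      rV = V.rank (A ++ x ∷ B)
      rF = F.rank (B ʳ++ x ∷ A′)
      vB = V.rank (B ++ [])
      fA = F.rank A′

      spans : ∀ {d} → d ∈ edgeList → d ∈ B ʳ++ x ∷ A′
      spans d∈ with ∈-++⁻ A (cover d∈)
      ... | inj₁ d∈A         = ∈-ʳ++ B (inj₁ (there (∈-ʳ++ A (inj₂ d∈A))))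
      ... | inj₂ (here d≡x)  = ∈-ʳ++ B (inj₁ (here d≡x))
      ... | inj₂ (there d∈B) = ∈-ʳ++ B (inj₂ d∈B)

      cover′ : ∀ {d} → d ∈ edgeList → d ∈ x ∷ A′ ⊎ d ∈ B ++ []
      cover′ d∈ with ∈-++⁻ A (cover d∈)
      ... | inj₁ d∈A         = inj₁ (there (∈-ʳ++ A (inj₂ d∈A)))
      ... | inj₂ (here d≡x)  = inj₁ (here d≡x)
      ... | inj₂ (there d∈B) = inj₂ (∈-++⁺ˡ d∈B)

      -- The segments `A` and `B` are bounded separately, and `x` between them is free: `connects`
      -- removes it from the primal rank here and `joins` from the dual rank in `segB`. The
      -- intermediate ranks `vB` and `fA` cancel in `total`.
      segA : rV + fA ≤ length A + vB
      segA = ℕ.≤-trans (rank-segment A (x ∷ B) [] A⊆ (λ d∈ → inj₂ (cover d∈)))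
        (ℕ.≤-reflexive (cong (length A +_) (trans (ℕ.+-identityʳ _)
          (trans (V.rank-∷-connected {B} {x} connects) (cong V.rank (sym (++-identityʳ B)))))))

      segB : vB + rF ≤ length B + fA
      segB = ℕ.≤-trans (rank-segment B [] (x ∷ A′) B⊆ cover′)
        (ℕ.≤-reflexive (cong (length B +_) (F.rank-∷-connected {A′} {x} joins)))

      total : rV + rF + (fA + vB) ≤ length A + length B + (fA + vB)
      total = begin
        rV + rF + (fA + vB)                   ≡⟨ left rV rF fA vB ⟩
        (rV + fA) + (vB + rF)                 ≤⟨ ℕ.+-mono-≤ segA segB ⟩
        (length A + vB) + (length B + fA)     ≡⟨ right (length A) (length B) fA vB ⟩
        length A + length B + (fA + vB)       ∎
        where
        left : ∀ a b c d → a + b + (c + d) ≡ (a + c) + (d + b)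
        left = solve-∀
        right : ∀ a b c d → (a + d) + (b + c) ≡ a + b + (c + d)
        right = solve-∀

    -- The Jordan curve theorem

    module CurveSeparation (planar : order + length faces ≡ 2 + numEdges)
      {P : Pred Dart 0ℓ} (P? : ∀ d → Dec (P d)) (P-reverse : ∀ {d} → P d → P (reverse d)) where

      offEdges : List Dart
      offEdges = filter (∁? P?) edgeList ʳ++ []

      -- L stands for the rest of the cycle, in any order and orientation.
      OnCycle : Dart → Set
      OnCycle x = P x × ∀ L → (∀ d → P d → d ≢ x → d ≢ reverse x → d ∈ L ⊎ reverse d ∈ L) → Connects L x

      private
        -- List the edges off the cycle first, then `x`, then the rest of the cycle, which connects
        -- the ends of `x`. If `x` also joined faces already joined across `offEdges`, it would
        -- raise neither rank, and `euler-<` would contradict equality in Euler's formula.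
        jordan-edge : ∀ {x} → x ∈ edgeList → OnCycle x → ¬ Joins offEdges x
        jordan-edge {x} x∈ (Px , cyc) joins
          with filter P? edgeList in on≡ | ∈-filter⁺ P? x∈ Px
        ... | _ | x∈on with B₁ , B₂ , refl ← ∈-∃++ x∈on =
          ℕ.<-irrefl refl (begin-strict
            2 + (length off + length (B₁ ++ B₂))  <⟨ ℕ.n<1+n _ ⟩
            2 + suc (length off + length (B₁ ++ B₂)) ≡⟨ cong (2 +_) lengths ⟩
            2 + numEdges                          ≡⟨ planar ⟨
            order + length faces                  ≤⟨ euler-< off x (B₁ ++ B₂) off⊆ B⊆ cover (cyc _ covers) joins ⟩
            2 + (length off + length (B₁ ++ B₂))  ∎)
          where
          open ℕ.≤-Reasoning
          off = filter (∁? P?) edgeList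
          off⊆ : All (_∈ edgeList) off
          off⊆ = All.tabulate (λ d∈ → proj₁ (∈-filter⁻ (∁? P?) {xs = edgeList} d∈))
          insert : ∀ {d} → d ∈ B₁ ++ B₂ → d ∈ B₁ ++ x ∷ B₂
          insert d∈ with ∈-++⁻ B₁ d∈
          ... | inj₁ d∈B₁ = ∈-++⁺ˡ d∈B₁
          ... | inj₂ d∈B₂ = ∈-++⁺ʳ B₁ (there d∈B₂)
          remove : ∀ {d} → d ∈ B₁ ++ x ∷ B₂ → d ≡ x ⊎ d ∈ B₁ ++ B₂
          remove d∈ with ∈-++⁻ B₁ d∈
          ... | inj₁ d∈B₁         = inj₂ (∈-++⁺ˡ d∈B₁)
          ... | inj₂ (here d≡x)   = inj₁ d≡x
          ... | inj₂ (there d∈B₂) = inj₂ (∈-++⁺ʳ B₁ d∈B₂)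
          B⊆ : All (_∈ edgeList) (B₁ ++ B₂)
          B⊆ = All.tabulate (λ d∈ → proj₁ (∈-filter⁻ P? {xs = edgeList} (subst (_ ∈_) (sym on≡) (insert d∈))))
          on-P : ∀ {d} → d ∈ edgeList → P d → d ≡ x ⊎ d ∈ B₁ ++ B₂
          on-P d∈ Pd = remove (subst (_ ∈_) on≡ (∈-filter⁺ P? d∈ Pd))
          cover : ∀ {d} → d ∈ edgeList → d ∈ off ++ x ∷ B₁ ++ B₂
          cover {d} d∈ with P? d
          ... | no ¬Pd = ∈-++⁺ˡ (∈-filter⁺ (∁? P?) d∈ ¬Pd)
          ... | yes Pd with on-P d∈ Pd
          ...   | inj₁ d≡x = ∈-++⁺ʳ off (here d≡x)
          ...   | inj₂ d∈B = ∈-++⁺ʳ off (there d∈B)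
          covers : ∀ d → P d → d ≢ x → d ≢ reverse x → d ∈ B₁ ++ B₂ ⊎ reverse d ∈ B₁ ++ B₂
          covers d Pd d≢x d≢x⁻¹ with orient d
          ... | inj₁ d∈ with on-P d∈ Pd
          ...   | inj₁ d≡x = contradiction d≡x d≢x
          ...   | inj₂ d∈B = inj₁ d∈B
          covers d Pd d≢x d≢x⁻¹ | inj₂ d∈ with on-P d∈ (P-reverse Pd)
          ...   | inj₁ eq  = contradiction (cong reverse eq) d≢x⁻¹
          ...   | inj₂ d∈B = inj₂ d∈B
          lengths : suc (length off + length (B₁ ++ B₂)) ≡ numEdges
          lengths = trans (sym (ℕ.+-suc (length off) _)) (trans (cong (length off +_) (trans
            (trans (cong suc (length-++ B₁)) (trans (sym (ℕ.+-suc _ _)) (sym (length-++ B₁))))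
            (cong length (sym on≡)))) (length-filter-∁ P? edgeList))

      infix 4 _~_

      abstract
        -- Two darts are related when their faces lie in the same region of the surface cut along
        -- the edges in `P`.
        _~_ : Rel Dart 0ℓ
        d ~ e = F.Conn offEdges (through d) (through e)

        _~?_ : Decidable _~_
        d ~? e = F.conn? offEdges (through d) (through e)

        ~-refl : ∀ {d} → d ~ d
        ~-refl {d} = F.conn-refl offEdges {through d}

        ~-sym : ∀ {d e} → d ~ e → e ~ d
        ~-sym {d} {e} = F.conn-sym offEdges {through d} {through e}

        ~-trans : ∀ {d e f} → d ~ e → e ~ f → d ~ f
        ~-trans {d} {e} {f} = F.conn-trans offEdges {through d} {through e} {through f}

        ~-φ : ∀ d → d ~ φ d
        ~-φ d = φ-conn offEdges d

        ~-reverse : ∀ {d} → ¬ P d → d ~ reverse d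
        ~-reverse {d} ¬Pd with orient d
        ... | inj₁ d∈ = F.conn-edge (∈-ʳ++ (filter (∁? P?) edgeList) (inj₂ (∈-filter⁺ (∁? P?) d∈ ¬Pd)))
        ... | inj₂ d∈ = F.conn-sym offEdges (F.conn-edge
          (∈-ʳ++ (filter (∁? P?) edgeList) (inj₂ (∈-filter⁺ (∁? P?) d∈ (¬Pd ∘ P-reverse)))))

        jordan : ∀ {x} → OnCycle x → ¬ x ~ reverse x
        jordan {x} on@(Px , cyc) joins with orient x
        ... | inj₁ x∈ = jordan-edge x∈ on joins
        ... | inj₂ x∈ = jordan-edge x∈
          (P-reverse Px , λ L covers → V.conn-sym L (cyc L (λ d Pd d≢x d≢x⁻¹ → covers d Pd d≢x⁻¹ d≢x)))
          (F.conn-sym offEdges joins)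

-- Polyhedral embeddings

module SimpleFaces {G : Graph} (E : Embedding G)
  (simple : ∀ d → Embedding.SimpleCycle E (Embedding.through d)) where
  open Graph G
  open GraphProperties G
  open Embedding E
  open EmbeddingProperties E

  len : Dart → ℕ
  len d = proj₁ (simple d)

  len≥3 : ∀ d → 3 ≤ len d
  len≥3 d = proj₁ (proj₂ (simple d))

  fold-len : ∀ d → fold d φ (len d) ≡ d
  fold-len d = proj₁ (proj₂ (proj₂ (simple d)))

  source-injective : ∀ d {i j} → i < len d → j < len d →
    source (fold d φ i) ≡ source (fold d φ j) → i ≡ j
  source-injective d = proj₂ (proj₂ (proj₂ (simple d))) _ _

  bounded : ∀ {d e} → d ≋ e → ∃[ i ] i < len d × fold d φ i ≡ e
  bounded {d} (k , refl) = k % len d , m%n<n k (len d) , fold-mod (fold-len d) k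
    where
    instance
      len≢0 : NonZero (len d)
      len≢0 = >-nonZero (ℕ.<-≤-trans (s≤s z≤n) (len≥3 d))

  same-source : ∀ {d e} → d ≋ e → source d ≡ source e → d ≡ e
  same-source {d} d≋e eq with bounded d≋e
  ... | i , i<n , refl = cong (fold d φ)
    (source-injective d (ℕ.<-≤-trans (s≤s z≤n) (len≥3 d)) i<n eq)

  same-source′ : ∀ {c d e} → c ≋ d → c ≋ e → source d ≡ source e → d ≡ e
  same-source′ p q = same-source (orbit-trans (orbit-sym p) q)

  -- Otherwise `φ d` and `reverse d`, which start at the same vertex of one face, coincide. Then the
  -- walk is back at the source of `d` after two steps, although its length is at least three.
  ¬reverse : ∀ d → ¬ d ≋ reverse d
  ¬reverse d p = ℕ.1+n≢0 (source-injective d (len≥3 d) (ℕ.<-≤-trans (s≤s z≤n) (len≥3 d)) loop)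
    where
    back : φ d ≡ reverse d
    back = same-source′ {d} (1 , refl) p (φ-source d)
    loop : source (fold d φ 2) ≡ source (fold d φ 0)
    loop = trans (φ-source (φ d)) (cong target back)

module PolyhedralEmbedding {G : Graph} (E : Embedding G) (poly : Embedding.Polyhedral E) where
  open Graph G
  open GraphProperties G
  open Embedding E
  open EmbeddingProperties E
  open SimpleFaces E (λ d → proj₁ poly (through d)) public

  -- `OnFace` and `OnFaceᵛ` are the edge and vertex predicates of `faceSubgraph (through c)`, so
  -- polyhedrality applies to them directly.
  OnFace : Dart → Dart → Set
  OnFace c d = c ≋ d ⊎ c ≋ reverse d

  OnFaceᵛ : Dart → Vertex → Set
  OnFaceᵛ c v = ∃[ d ] c ≋ d × source d ≡ v

  onFace-source : ∀ {c d} → OnFace c d → OnFaceᵛ c (source d)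
  onFace-source {d = d} (inj₁ p) = d , p , refl
  onFace-source {d = d} (inj₂ p) = φ (reverse d) , φ-step p , φ-source (reverse d)

  shared-edge : ∀ {a b x y} → ¬ a ≋ b → OnFace a x → OnFace b x → OnFace a y → OnFace b y →
                y ≡ x ⊎ y ≡ reverse x
  shared-edge {a} {b} a≉b ax bx ay by with proj₂ poly (through a) (through b) a≉b
  ... | inj₁ (_ , (⊆∅ , _))                 = ⊥-elim (⊆∅ (ax , bx))
  ... | inj₂ (inj₁ (_ , _ , (⊆∅ , _)))      = ⊥-elim (⊆∅ (ax , bx))
  ... | inj₂ (inj₂ (_ , _ , (⊆e , _))) with ⊆e (ax , bx) | ⊆e (ay , by)
  ...   | inj₁ refl | inj₁ refl = inj₁ refl
  ...   | inj₁ refl | inj₂ refl = inj₂ refl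
  ...   | inj₂ refl | inj₁ refl = inj₂ refl
  ...   | inj₂ refl | inj₂ refl = inj₁ refl

  φ-≢ : ∀ d → φ d ≢ d
  φ-≢ d eq = source≢target d (trans (cong source (sym eq)) (φ-source d))

  φ-≢-reverse : ∀ d → φ d ≢ reverse d
  φ-≢-reverse d eq = ¬reverse d (1 , eq)

-- Faces of a polyhedral embedding as faces of a plane embedding

module FaceOfPlane {G : Graph} (connected : Graph.Connected G) (E₀ E : Embedding G)
  (planar : Graph.order G + length (Embedding.faces E₀) ≡ 2 + Graph.numEdges G)
  (poly : Embedding.Polyhedral E) where
  open Graph G
  open GraphProperties G
  open Embedding E
  open EmbeddingProperties E
  open PolyhedralEmbedding E poly
  module E₀ = Embedding E₀
  module P₀ = EmbeddingProperties E₀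

  order≢1 : order ≢ 1
  order≢1 p = proj₁ poly (trivial p)

  φ₀ : Dart → Dart
  φ₀ = E₀.φ

  module Around (c : Dart) where

    abstract
      onFace? : ∀ d → Dec (OnFace c d)
      onFace? d = orbit? _≟ᵈ_ c d ⊎-dec orbit? _≟ᵈ_ c (reverse d)

      onFaceᵛ? : ∀ v → Dec (OnFaceᵛ c v)
      onFaceᵛ? v = map′ (λ a → let d , _ , p = find a in d , p)
        (λ (d , p) → lose {P = λ d → c ≋ d × source d ≡ v} (∈-darts d) p)
        (Any.any? (λ d → orbit? _≟ᵈ_ c d ×-dec (source d Fin.≟ v)) darts)

    open EulerFormula.CurveSeparation E₀ connected order≢1 planar onFace? Sum.swap public
      using (_~_; _~?_; ~-refl; ~-sym; ~-trans; ~-reverse; jordan) renaming (~-φ to ~-φ₀)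

    -- No edge at a vertex off the face of `c` belongs to that face, so the rotation of `E₀` there
    -- never crosses the curve.
    ~-around : ∀ {d e} → ¬ OnFaceᵛ c (source d) → source d ≡ source e → d ~ e
    ~-around {d} {e} off eq with E₀.nx-cyclic d e eq
    ... | k , refl = proj₁ (go k)
      where
      go : ∀ k → d ~ fold d E₀.nx k × source (fold d E₀.nx k) ≡ source d
      go zero    = ~-refl , refl
      go (suc k) with d~ , eq ← go k =
          ~-trans d~ (~-trans (~-reverse (λ on → off (subst (OnFaceᵛ c) eq (onFace-source on))))
                              (~-φ₀ (reverse (fold d E₀.nx k))))
        , trans (E₀.nx-source _) eq

    -- A step along a face of `E` is imitated in `E₀`: cross the edge of `d`, then rotate around the
    -- target of `d`, where `φ d` starts.
    ~-φ : ∀ d → ¬ OnFaceᵛ c (target d) → d ~ φ d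
    ~-φ d off = ~-trans (~-reverse (λ on → off (onFace-source (Sum.swap on))))
                        (~-around off (sym (φ-source d)))

    ~-walk : ∀ y a → (∀ j → a < j → j < len y → ¬ OnFaceᵛ c (source (fold y φ j))) →
             ∀ m → m + a < len y → fold y φ a ~ fold y φ (m + a)
    ~-walk y a off zero    _  = ~-refl
    ~-walk y a off (suc m) lt = ~-trans (~-walk y a off m (ℕ.<-trans (ℕ.n<1+n _) lt))
      (~-φ (fold y φ (m + a)) (subst (λ v → ¬ OnFaceᵛ c v) (φ-source (fold y φ (m + a)))
        (off (suc m + a) (s≤s (ℕ.m≤n+m a m)) lt)))

    -- By polyhedrality the face of d meets that of c at most in the first vertices
    -- of its boundary walk from a suitable dart y.
    ~-face : ∀ {d e} → ¬ OnFace c d → ¬ OnFace c e → d ≋ e → d ~ e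
    ~-face {d} {e} ¬d ¬e d≋e = by-cases (proj₂ poly (through c) (through d) (λ c≋d → ¬d (inj₁ c≋d)))
      where
      from : ∀ y a → d ≋ y → (∀ j → a < j → j < len y → ¬ OnFaceᵛ c (source (fold y φ j))) →
             (∀ i → ¬ OnFace c (fold y φ i) → a ≤ i) → d ~ e
      from y a d≋y off first = ~-trans (~-sym (reach (orbit-sym d≋y) ¬d))
                                       (reach (orbit-trans (orbit-sym d≋y) d≋e) ¬e)
        where
        reach : ∀ {z} → y ≋ z → ¬ OnFace c z → fold y φ a ~ z
        reach y≋z ¬z with bounded y≋z
        ... | i , i<n , refl = subst (λ j → fold y φ a ~ fold y φ j) (ℕ.m∸n+n≡m a≤i)
          (~-walk y a off (i ∸ a) (subst (_< len y) (sym (ℕ.m∸n+n≡m a≤i)) i<n))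
          where a≤i = first i ¬z

      on-d : ∀ {y} → d ≋ y → ∀ j → OnFaceᵛ d (source (fold y φ j))
      on-d {y} d≋y j = fold y φ j , orbit-trans d≋y (j , refl) , refl

      from-edge : ∀ y → d ≋ y → OnFace c y →
        (∀ {v} → OnFaceᵛ c v × OnFaceᵛ d v → v ≡ source y ⊎ v ≡ target y) → d ~ e
      -- Position 0 is the shared edge itself; position 1 starts at its second end, the last vertex
      -- of the walk on the face of `c`.
      from-edge y d≋y on ends = from y 1 d≋y
        (λ j 1<j j<n on′ → separate-ends j 1<j j<n (ends (on′ , on-d d≋y j)))
        (λ { zero ¬y → ⊥-elim (¬y on) ; (suc i) _ → s≤s z≤n })
        where
        separate-ends : ∀ j → 1 < j → j < len y →
          ¬ (source (fold y φ j) ≡ source y ⊎ source (fold y φ j) ≡ target y)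
        separate-ends j 1<j j<n (inj₁ eq) = ℕ.<⇒≢ (ℕ.<-trans (s≤s z≤n) 1<j)
          (sym (source-injective y j<n (ℕ.<-≤-trans (s≤s z≤n) (len≥3 y)) eq))
        separate-ends j 1<j j<n (inj₂ eq) = ℕ.<⇒≢ 1<j
          (sym (source-injective y j<n (ℕ.<-≤-trans (s≤s (s≤s z≤n)) (len≥3 y)) (trans eq (sym (φ-source y)))))

      by-cases : _ → d ~ e
      by-cases (inj₁ ((⊆∅ , _) , _)) = from d 0 orbit-refl
        (λ j _ _ on → ⊆∅ (on , on-d orbit-refl j)) (λ _ _ → z≤n)
      -- Starting the walk at the common vertex keeps all later positions off the face of `c`.
      by-cases (inj₂ (inj₁ (v , (⊆v , v⊆) , _))) with v⊆ refl
      ... | _ , (y , d≋y , refl) = from y 0 d≋y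
        (λ j 0<j j<n on → ℕ.<⇒≢ 0<j (source-injective y (ℕ.<-trans 0<j j<n) j<n (⊆v (on , on-d d≋y j))))
        (λ _ _ → z≤n)
      by-cases (inj₂ (inj₂ (x , (⊆x , _) , (_ , x⊆)))) with x⊆ (inj₁ refl)
      ... | on , inj₁ d≋x  = from-edge x d≋x on ⊆x
      ... | on , inj₂ d≋x⁻¹ = from-edge (reverse x) d≋x⁻¹ (Sum.swap on) (λ p → Sum.swap (⊆x p))

    -- A simple face passes each of its vertices once, so its only edges there are the one leaving
    -- and the one arriving.
    at-face-vertex : ∀ {d y} → c ≋ d → OnFace c y → source y ≡ source d → y ≡ d ⊎ φ (reverse y) ≡ d
    at-face-vertex c≋d (inj₁ c≋y)   eq = inj₁ (same-source′ c≋y c≋d eq)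
    at-face-vertex {y = y} c≋d (inj₂ c≋y⁻¹) eq =
      inj₂ (same-source′ (φ-step c≋y⁻¹) c≋d (trans (φ-source (reverse y)) eq))

    -- The reference dart, whose region is shown to contain every edge off the face of `c`. It lies
    -- on the neighbouring face across `c`.
    k₀ : Dart
    k₀ = φ (reverse c)

    -- A property of the face of `d` in `E`, since `d` itself may lie on the curve. By `~-face`, one
    -- dart `z` off the curve in the region of `k₀` decides for all others of that face.
    Seen : Dart → Set
    Seen d = ∃[ z ] d ≋ z × ¬ OnFace c z × k₀ ~ z

    seen-φ : ∀ {d} → Seen d → Seen (φ d)
    seen-φ (z , d≋z , rest) = z , orbit-trans (orbit-sym (1 , refl)) d≋z , rest

    seen-off : ∀ {d} → ¬ OnFace c d → Seen d → k₀ ~ d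
    seen-off ¬d (z , d≋z , ¬z , k₀~z) = ~-trans k₀~z (~-sym (~-face ¬d ¬z d≋z))

    seen-reverse : ∀ {d} → ¬ OnFace c d → Seen d → Seen (reverse d)
    seen-reverse {d} ¬d s = reverse d , orbit-refl , ¬d ∘ Sum.swap , ~-trans (seen-off ¬d s) (~-reverse ¬d)

    ¬seen : ∀ {d} → c ≋ d → ¬ Seen d
    ¬seen c≋d (z , d≋z , ¬z , _) = ¬z (inj₁ (orbit-trans c≋d d≋z))

    -- Rotating around a vertex of the face, either the face on the other side of x has been
    -- seen, or x is the last edge before that face.
    seen-rotate : ∀ {d} → c ≋ d → Seen (reverse d) → ∀ x → source x ≡ source d →
                  Seen (reverse x) ⊎ (φ (reverse x) ≡ d × Seen x)
    seen-rotate {d} c≋d seen x eq with nx-cyclic d x (sym eq)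
    ... | k , refl = proj₁ (go k)
      where
      Rotated : Dart → Set
      Rotated x = Seen (reverse x) ⊎ (φ (reverse x) ≡ d × Seen x)
      step : ∀ x → source x ≡ source d → Rotated x → Rotated (nx x)
      step x eq (inj₂ (nx≡d , _)) = inj₁ (subst (Seen ∘ reverse) (sym nx≡d) seen)
      step x eq (inj₁ s) with onFace? (nx x)
      ... | no ¬y = inj₁ (seen-reverse ¬y (seen-φ s))
      ... | yes on with at-face-vertex c≋d on (trans (nx-source x) eq)
      ...   | inj₁ nx≡d = inj₁ (subst (Seen ∘ reverse) (sym nx≡d) seen)
      ...   | inj₂ last = inj₂ (last , seen-φ s)
      go : ∀ k → Rotated (fold d nx k) × source (fold d nx k) ≡ source d
      go zero    = inj₁ seen , refl
      go (suc k) with r , eq ← go k = step _ eq r , trans (nx-source _) eq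

    off-at-vertex : ∀ {d} → c ≋ d → Seen (reverse d) → ∀ x → source x ≡ source d → ¬ OnFace c x → k₀ ~ x
    off-at-vertex c≋d seen x eq ¬x with seen-rotate c≋d seen x eq
    ... | inj₁ s          = ~-trans (seen-off (¬x ∘ Sum.swap) s) (~-sym (~-reverse ¬x))
    ... | inj₂ (last , _) = ⊥-elim (¬x (inj₂ (φ-unstep (subst (c ≋_) (sym last) c≋d))))

    -- Rotate at the vertex between `d` and `φ d`, from the face across `φ d` up to the edge of `d`.
    -- The face of `d` is never seen, so the rotation ends with the face across `d`.
    seen-previous : ∀ {d} → c ≋ d → Seen (reverse (φ d)) → Seen (reverse d)
    seen-previous {d} c≋d seen with seen-rotate (φ-step c≋d) seen (reverse d) (sym (φ-source d))
    ... | inj₁ s       = ⊥-elim (¬seen c≋d s)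
    ... | inj₂ (_ , s) = s

    seen-start : Seen (reverse c)
    seen-start = k₀ , (1 , refl) , ¬k₀ , ~-refl
      where
      ¬k₀ : ¬ OnFace c k₀
      -- Otherwise the faces of `c` and `reverse c` would share the edge of `k₀` besides that of
      -- `c`.
      ¬k₀ on with shared-edge (¬reverse c) (inj₂ orbit-refl) (inj₁ orbit-refl) on (inj₁ (1 , refl))
      ... | inj₁ eq = φ-≢ (reverse c) eq
      ... | inj₂ eq = φ-≢-reverse (reverse c) eq

    -- The face is a cycle, so induction backwards along it reaches all its darts.
    backwards : ∀ {Q : Dart → Set} → Q c → (∀ {d} → c ≋ d → Q (φ d) → Q d) → ∀ {d} → c ≋ d → Q d
    backwards {Q} base step c≋d = go (proj₁ (orbit-sym c≋d)) c≋d (proj₂ (orbit-sym c≋d))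
      where
      go : ∀ k {d} → c ≋ d → fold d φ k ≡ c → Q d
      go zero    c≋d refl = base
      go (suc k) {d} c≋d eq = step c≋d (go k (φ-step c≋d) (trans (fold-shift φ d k) eq))

    -- Carry along a walk from the face the invariant that all darts at the current vertex off the
    -- face of `c` are joined to `k₀`. At a vertex of the face it comes from the neighbouring faces,
    -- elsewhere from crossing the last edge and rotating.
    off-joined : ∀ x → ¬ OnFace c x → k₀ ~ x
    off-joined x = along (proj₂ connected (source c) (source x)) (at (c , orbit-refl , refl)) x refl
      where
      Joined : Vertex → Set
      Joined v = ∀ x → source x ≡ v → ¬ OnFace c x → k₀ ~ x
      at : ∀ {v} → OnFaceᵛ c v → Joined v
      at (d , c≋d , refl) = off-at-vertex c≋d (backwards {Seen ∘ reverse} seen-start seen-previous c≋d)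
      along : ∀ {u v} → Star Adj u v → Joined u → Joined v
      along ε              joined = joined
      along {u} (_◅_ {j = w} a walk) joined with onFaceᵛ? w
      ... | yes on = along walk (at on)
      ... | no off = along walk λ y eq _ →
        ~-trans (joined (dart u w a) refl ¬a) (~-trans (~-reverse ¬a) (~-around off (sym eq)))
        where
        ¬a : ¬ OnFace c (dart u w a)
        ¬a on = off (onFace-source (Sum.swap on))

    -- The other edges of the simple face form a path from the target of `x` back to its source, so
    -- the Jordan curve theorem applies at `x`.
    sides-apart : ∀ {x} → c ≋ x → ¬ x ~ reverse x
    sides-apart {x} c≋x = jordan (inj₁ c≋x , path)
      where
      path : ∀ L → (∀ d → OnFace c d → d ≢ x → d ≢ reverse x → d ∈ L ⊎ reverse d ∈ L) → Connects L x
      path L covers = subst₂ (V.Conn L) eq-end (φ-source x) (V.conn-sym L (go (len x ∸ 1) ℕ.≤-refl))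
        where
        suc-pred : suc (len x ∸ 1) ≡ len x
        suc-pred = ℕ.m+[n∸m]≡n (ℕ.≤-trans (s≤s z≤n) (len≥3 x))
        eq-end : source (fold x φ (suc (len x ∸ 1))) ≡ source x
        eq-end = cong source (trans (cong (fold x φ) suc-pred) (fold-len x))
        edge : ∀ m → suc m < len x → V.Conn L (source (fold x φ (suc m))) (target (fold x φ (suc m)))
        edge m lt = [ V.conn-edge , (λ d∈ → V.conn-sym L (V.conn-edge d∈)) ]′
          (covers (fold x φ (suc m)) (inj₁ (orbit-trans c≋x (suc m , refl)))
            (λ eq → ℕ.1+n≢0 (source-injective x lt (ℕ.<-≤-trans (s≤s z≤n) (len≥3 x)) (cong source eq)))
            (λ eq → ¬reverse x (suc m , eq)))
        go : ∀ m → m ≤ len x ∸ 1 → V.Conn L (source (φ x)) (source (fold x φ (suc m)))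
        go zero    _  = V.conn-refl L
        go (suc m) le = V.conn-trans L (go m (ℕ.≤-trans (ℕ.n≤1+n m) le))
          (subst (V.Conn L (source (fold x φ (suc m)))) (sym (φ-source (fold x φ (suc m)))) (edge m (subst (suc (suc m) ≤_) suc-pred (s≤s le))))

    turn : ∀ {d y} → c ≋ d → OnFace c y → source y ≡ target d → y ≡ φ d ⊎ y ≡ reverse d
    turn {d} {y} c≋d on eq = Sum.map₂ (λ last → cong reverse (φ-injective {reverse y} {d} last))
      (at-face-vertex (φ-step c≋d) on (trans eq (sym (φ-source d))))

    unjoined⇒onFace : ∀ {r} → ¬ k₀ ~ r → ∀ {y} → r ~ y → OnFace c y
    unjoined⇒onFace ¬r {y} r~y = decidable-stable (onFace? y) (λ ¬y → ¬r (~-trans (off-joined y ¬y) (~-sym r~y)))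

    -- The dart `φ₀ d` is in the region of `d`, hence on the face of `c`, and starts at the target
    -- of `d`. It is therefore `φ d` or `reverse d`, and the latter would join the two sides of `d`.
    forwards : ¬ k₀ ~ c → ∀ {d} → c ≋ d → c ~ d → φ₀ d ≡ φ d
    forwards ¬c {d} c≋d c~d = [ (λ eq → eq) , (λ eq → ⊥-elim (sides-apart c≋d (subst (d ~_) eq (~-φ₀ d)))) ]′
      (turn c≋d (unjoined⇒onFace ¬c (~-trans c~d (~-φ₀ d))) (P₀.φ-source d))

    forwards-joined : ¬ k₀ ~ c → ∀ k → c ~ fold c φ k
    forwards-joined ¬c zero    = ~-refl
    forwards-joined ¬c (suc k) = ~-trans (forwards-joined ¬c k)
      (subst (fold c φ k ~_) (forwards ¬c (k , refl) (forwards-joined ¬c k)) (~-φ₀ (fold c φ k)))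

    reversed : ¬ k₀ ~ reverse c → ∀ {d} → c ≋ d → reverse c ~ reverse (φ d) → φ₀ (reverse (φ d)) ≡ reverse d
    reversed ¬c {d} c≋d c~d =
      [ (λ eq → ⊥-elim (sides-apart (φ-step c≋d) (~-sym (subst (reverse (φ d) ~_) eq (~-φ₀ (reverse (φ d)))))))
      , (λ eq → eq) ]′
      (turn c≋d (unjoined⇒onFace ¬c (~-trans c~d (~-φ₀ (reverse (φ d)))))
        (trans (P₀.φ-source (reverse (φ d))) (φ-source d)))

    reversed-joined : ¬ k₀ ~ reverse c → ∀ {d} → c ≋ d → reverse c ~ reverse d
    reversed-joined ¬c = backwards {λ d → reverse c ~ reverse d} ~-refl
      (λ {d} c≋d c~ → ~-trans c~ (subst (reverse (φ d) ~_) (reversed ¬c c≋d c~) (~-φ₀ (reverse (φ d)))))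

  -- The boundary of the face of `c` is a facial walk of `E₀` in the same direction or in the
  -- opposite one.
  Positive Negative : Dart → Set
  Positive c = ∀ {d} → c ≋ d → φ₀ d ≡ φ d
  Negative c = ∀ {d} → c ≋ d → φ₀ (reverse (φ d)) ≡ reverse d

  -- One side of c is not joined to the darts off the face of c, so the face of E₀ on that
  -- side uses only edges of the face of c.
  sign : ∀ c → Positive c ⊎ Negative c
  sign c = by-cases (k₀ ~? c)
    where
    open Around c
    by-cases : Dec (k₀ ~ c) → Positive c ⊎ Negative c
    by-cases (no ¬c)    = inj₁ λ { (k , refl) → forwards ¬c (k , refl) (forwards-joined ¬c k) }
    by-cases (yes k₀~c) = inj₂ λ c≋d → reversed ¬c⁻¹ c≋d (reversed-joined ¬c⁻¹ (φ-step c≋d))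
      where
      ¬c⁻¹ : ¬ k₀ ~ reverse c
      ¬c⁻¹ k₀~c⁻¹ = sides-apart orbit-refl (~-trans (~-sym k₀~c) k₀~c⁻¹)

  -- Otherwise the faces of c and reverse c would share two edges.
  signs-agree : ∀ c → Positive c → ¬ Negative (reverse c)
  signs-agree c pos neg = [ φ-≢ c , φ-≢-reverse c ]′
    (shared-edge (¬reverse c) (inj₁ orbit-refl) (inj₂ orbit-refl) (inj₁ (1 , refl)) (inj₂ (k , sym φc⁻¹≡d)))
    where
    -- `d` is the predecessor of `reverse c` on its face. The two signs force `φ c` to be
    -- `reverse d`, which gives the second common edge.
    loop = orbit-sym {reverse c} {φ (reverse c)} (1 , refl)
    k = proj₁ loop
    d = fold (reverse c) φ k
    φd≡c⁻¹ : φ d ≡ reverse c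
    φd≡c⁻¹ = trans (sym (fold-shift φ (reverse c) k)) (proj₂ loop)
    φc⁻¹≡d : reverse (φ c) ≡ d
    φc⁻¹≡d = cong reverse (trans (sym (pos orbit-refl))
      (trans (cong (φ₀ ∘ reverse) (sym φd≡c⁻¹)) (neg {d} (k , refl))))

  -- The face of `E₀` through `d` has the same boundary as the face of `E` through `mirror d`. If
  -- `d` is negative, so is `reverse d`, and reversing the walk through `reverse d` gives a walk
  -- through `d`.
  mirror : Dart → Dart
  mirror d = [ (λ _ → d) , (λ _ → reverse d) ]′ (sign d)

  positive-orbit : ∀ {d e} → Positive d → d ≋ e → Orbit φ₀ d e
  positive-orbit {d} pos (k , refl) = go k
    where
    go : ∀ k → Orbit φ₀ d (fold d φ k)
    go zero    = P₀.orbit-refl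
    go (suc k) = P₀.orbit-trans (go k) (1 , pos (k , refl))

  negative-orbit : ∀ {d e} → Negative d → d ≋ e → Orbit φ₀ (reverse d) (reverse e)
  negative-orbit {d} neg (k , refl) = go k
    where
    go : ∀ k → Orbit φ₀ (reverse d) (reverse (fold d φ k))
    go zero    = P₀.orbit-refl
    go (suc k) = P₀.orbit-trans (go k) (P₀.orbit-sym (1 , neg (k , refl)))

  mirror-reflects : ∀ d e → mirror d ≋ mirror e → Orbit φ₀ d e
  mirror-reflects d e p with sign d | sign e
  ... | inj₁ pos  | inj₁ _   = positive-orbit pos p
  -- Signs are constant on a face of `E`, so a mixed pair would make a dart positive and its reverse
  -- negative.
  ... | inj₁ pos  | inj₂ neg = ⊥-elim (signs-agree (reverse e) (λ q → pos (orbit-trans p q)) neg)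
  ... | inj₂ neg  | inj₁ pos = ⊥-elim (signs-agree (reverse d) (λ q → pos (orbit-trans (orbit-sym p) q)) neg)
  ... | inj₂ neg  | inj₂ _ with sign (reverse d)
  ...   | inj₁ pos′ = ⊥-elim (signs-agree (reverse d) pos′ neg)
  ...   | inj₂ neg′ = negative-orbit neg′ p

  mirrorFace : E₀.Face → Face
  mirrorFace (E₀.through d) = through (mirror d)
  mirrorFace (E₀.trivial p) = trivial p

  mirrorFace-reflects : ∀ F F′ → mirrorFace F ≈ᶠ mirrorFace F′ → F E₀.≈ᶠ F′
  mirrorFace-reflects (E₀.through d) (E₀.through e) p = mirror-reflects d e p
  mirrorFace-reflects (E₀.trivial p) _ _ = ⊥-elim (order≢1 p)
  mirrorFace-reflects (E₀.through _) (E₀.trivial p) _ = ⊥-elim (order≢1 p)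

  faces-complete : ∀ F → Any.Any (F ≈ᶠ_) faces
  faces-complete (trivial p) = ⊥-elim (order≢1 p)
  faces-complete (through d) = Any.deduplicate⁺ _≈ᶠ?_ (λ {F} {F′} p q → ≈ᶠ.trans {through d} {F} {F′} q (≈ᶠ.sym {F′} {F} p))
    (Any.++⁺ˡ (lose (∈-map⁺ through (∈-darts d)) (≈ᶠ.refl {through d})))
    where module ≈ᶠ = IsEquivalence ≈ᶠ-isEquivalence

  faces₀≤faces : length E₀.faces ≤ length faces
  faces₀≤faces = separated-length (EulerFormula.faces-separated E₀) (λ {F} {F′} → ≈₀.sym {F} {F′})
    (λ {F} {F′} {F″} p q → mirrorFace-reflects F F′ (≈ᶠ.trans {mirrorFace F} {F″} {mirrorFace F′} p (≈ᶠ.sym {mirrorFace F′} {F″} q)))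
    (λ {F} _ → faces-complete (mirrorFace F))
    where
    module ≈ᶠ = IsEquivalence ≈ᶠ-isEquivalence
    module ≈₀ = IsEquivalence E₀.≈ᶠ-isEquivalence

  -- Euler's inequality for `E` against equality for `E₀` bounds the number of faces from above, and
  -- `mirrorFace` bounds it from below.
  faces≡ : length faces ≡ length E₀.faces
  faces≡ = ℕ.≤-antisym
    (ℕ.+-cancelˡ-≤ order _ _ (ℕ.≤-trans (EulerFormula.euler-≤ E connected order≢1) (ℕ.≤-reflexive (sym planar))))
    faces₀≤faces

polyhedral-genus : (G : Graph) → Graph.Connected G → Planar G → (E : Embedding G) →
  Embedding.Polyhedral E → Embedding.genus E ≡ 0ℚ
polyhedral-genus G connected (E₀ , genus₀) E poly =
  trans (cong (λ f → (ℤ.+ 2 ℤ.- ((ℤ.+ order ℤ.- ℤ.+ numEdges) ℤ.+ ℤ.+ f)) ℚ./ 2) faces≡) genus₀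
  where
  open Graph G
  open FaceOfPlane connected E₀ E (EulerFormula.genus-0 E₀ genus₀) poly

-- Cubic graphs

module CubicSimpleDual {G : Graph} (cubic : Graph.Cubic G) (E : Embedding G)
  (dual-simple : Multigraph.Simple (Embedding.dual E)) where
  open Graph G
  open GraphProperties G
  open Embedding E
  open EmbeddingProperties E

  order≢1 : order ≢ 1
  order≢1 order≡1 = ℕ.<⇒≱ (s≤s (s≤s z≤n)) (begin
    3                     ≡⟨ cubic v ⟨
    degree v              ≤⟨ length-filter (adj? v) (allFin order) ⟩
    length (allFin order) ≡⟨ length-tabulate _ ⟩
    order                 ≡⟨ order≡1 ⟩
    1                     ∎)
    where
    open ℕ.≤-Reasoning
    v : Vertex
    v = subst Fin.Fin (sym order≡1) Fin.zero

  same-ends : ∀ {d e} → source d ≡ source e → target d ≡ target e → d ≡ e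
  same-ends s≡ t≡ = dartCode-injective (cong₂ Fin.combine s≡ t≡)

  ∈-neighbours : ∀ d → target d ∈ filter (adj? (source d)) (allFin order)
  ∈-neighbours (dart u v a) = ∈-filter⁺ (adj? u) (∈-allFin v) (recompute (adj? u v) a)

  at-most-three : ∀ {v ds} → Unique ds → All (λ d → source d ≡ v) ds → length ds ≤ 3
  at-most-three {v} {ds} unique at-v = ℕ.≤-trans
    (separated-length {S = λ d w → source d ≡ v × target d ≡ w} unique sym
      (λ { (s , refl) (s′ , t) → same-ends (trans s (sym s′)) (sym t) }) neighbour)
    (ℕ.≤-reflexive (cubic v))
    where
    neighbour : ∀ {d} → d ∈ ds → Any.Any (λ w → source d ≡ v × target d ≡ w) (filter (adj? v) (allFin order))
    neighbour {d} d∈ with All.lookup at-v d∈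
    ... | refl = Any.map (refl ,_) (∈-neighbours d)

  fixed-orbit : ∀ {d e} → source d ≡ source e → nx d ≡ d → d ≡ e
  fixed-orbit {d} {e} s≡ nx≡ with nx-cyclic d e s≡
  ... | k , refl = go k
    where
    go : ∀ k → d ≡ fold d nx k
    go zero    = refl
    go (suc k) = trans (sym nx≡) (cong nx (go k))

  -- Otherwise `x`, `y`, `nx x` and `nx y` would be four distinct darts at a vertex of degree three.
  consecutive : ∀ {x y} → x ≢ y → source x ≡ source y → nx x ≡ y ⊎ nx y ≡ x
  consecutive {x} {y} x≢y s≡ with nx x ≟ᵈ y | nx y ≟ᵈ x
  ... | yes eq | _      = inj₁ eq
  ... | no  _  | yes eq = inj₂ eq
  ... | no x′≢y | no y′≢x = ⊥-elim (ℕ.<-irrefl refl (at-most-three {source x} {x ∷ y ∷ nx x ∷ nx y ∷ []}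
    ((x≢y ∷ (x≢y ∘ fixed-orbit s≡ ∘ sym) ∷ (y′≢x ∘ sym) ∷ [])
      ∷ ((x′≢y ∘ sym) ∷ (x≢y ∘ sym ∘ fixed-orbit (sym s≡) ∘ sym) ∷ [])
      ∷ ((x≢y ∘ nx-injective) ∷ []) ∷ [] ∷ [])
    (refl ∷ sym s≡ ∷ nx-source x ∷ trans (nx-source y) (sym s≡) ∷ [])))

  no-loop : ∀ {d} → ¬ d ≋ reverse d
  no-loop {d} = proj₁ dual-simple d

  -- Of two darts at a vertex one follows the other, and `nx x` lies on the face of `reverse x`. If
  -- both were on one face, the dual would have a loop.
  face-source-injective : ∀ {x y} → x ≋ y → source x ≡ source y → x ≡ y
  face-source-injective {x} {y} x≋y s≡ with x ≟ᵈ y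
  ... | yes x≡y = x≡y
  ... | no x≢y with consecutive x≢y s≡
  ...   | inj₁ refl = ⊥-elim (no-loop (φ-unstep x≋y))
  ...   | inj₂ refl = ⊥-elim (no-loop (φ-unstep (orbit-sym x≋y)))

  simple-cycle : ∀ d → SimpleCycle (through d)
  simple-cycle d with period d
  -- Searching over `suc m` yields the least positive period.
  ... | suc p , _ , eq with least (λ m → fold d φ (suc m) ≟ᵈ d) p eq
  ...   | m , φⁿ≡ , minimal = suc m , length≥3 m φⁿ≡ , φⁿ≡ , injective
    where
    length≥3 : ∀ m → fold d φ (suc m) ≡ d → 3 ≤ suc m
    length≥3 zero          eq = ⊥-elim (source≢target d (trans (cong source (sym eq)) (φ-source d)))
    length≥3 (suc zero)    eq = ⊥-elim (no-loop {d} (1 , same-ends (φ-source d)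
      (trans (sym (φ-source (φ d))) (cong source eq))))
    length≥3 (suc (suc m)) eq = s≤s (s≤s (s≤s z≤n))

    distinct : ∀ {i j} → i < j → j < suc m → fold d φ i ≢ fold d φ j
    distinct {i} {j} i<j (s≤s j≤m) eq with ℕ.m≤n⇒∃[o]m+o≡n i<j
    ... | k , refl = minimal k (ℕ.<-≤-trans (s≤s (ℕ.m≤n+m k i)) j≤m)
      (fold-injective i (trans (sym (fold-+ d φ i)) (trans (cong (fold d φ) (ℕ.+-suc i k)) (sym eq))))

    injective : ∀ i j → i < suc m → j < suc m → source (fold d φ i) ≡ source (fold d φ j) → i ≡ j
    injective i j i< j< eq with ℕ.<-cmp i j
                              | face-source-injective (orbit-trans (orbit-sym {d} (i , refl)) (j , refl)) eq
    ... | tri< i<j _ _ | eq′ = ⊥-elim (distinct i<j j< eq′)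
    ... | tri≈ _ i≡j _ | _   = i≡j
    ... | tri> _ _ j<i | eq′ = ⊥-elim (distinct j<i i< (sym eq′))

  polyhedral : Polyhedral
  polyhedral = simple-cycles , intersection
    where
    simple-cycles : ∀ F → SimpleCycle F
    simple-cycles (through d) = simple-cycle d
    simple-cycles (trivial p) = ⊥-elim (order≢1 p)

    intersection : _
    intersection (trivial p) _           _ = ⊥-elim (order≢1 p)
    intersection (through _) (trivial p) _ = ⊥-elim (order≢1 p)
    intersection (through e) (through e′) e≉e′ =
      by-cases (Any.any? (λ d → orbit? _≟ᵈ_ e d ×-dec orbit? _≟ᵈ_ e′ (reverse d)) darts)
      where
      I = faceSubgraph (through e) ∩ˢ faceSubgraph (through e′)

      Shared : Dart → Set
      Shared d = e ≋ d × e′ ≋ reverse d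

      -- The darts of the two faces at a common vertex are consecutive, so the edge of the earlier
      -- one separates the two faces.
      shared-at : ∀ {v} → vertices I v → ∃[ b ] Shared b × (v ≡ source b ⊎ v ≡ target b)
      shared-at ((d , e≋d , refl) , (d′ , e′≋d′ , s≡))
        with consecutive {d} {d′} (λ { refl → e≉e′ (orbit-trans e≋d (orbit-sym e′≋d′)) }) (sym s≡)
      ... | inj₁ refl = d , (e≋d , φ-unstep e′≋d′) , inj₁ refl
      ... | inj₂ refl = reverse d′ , (φ-unstep e≋d , e′≋d′) , inj₂ (sym s≡)

      shared-dart : ∀ {d} → edges I d → Shared d ⊎ Shared (reverse d)
      shared-dart (inj₁ p , inj₁ q) = ⊥-elim (e≉e′ (orbit-trans p (orbit-sym q)))
      shared-dart (inj₁ p , inj₂ q) = inj₁ (p , q)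
      shared-dart (inj₂ p , inj₁ q) = inj₂ (p , q)
      shared-dart (inj₂ p , inj₂ q) = ⊥-elim (e≉e′ (orbit-trans p (orbit-sym q)))

      shared-unique : ∀ {a b} → Shared a → Shared b → b ≡ a ⊎ b ≡ reverse a
      shared-unique {a} {b} (e≋a , e′≋a) (e≋b , e′≋b) = proj₂ dual-simple a b
        (orbit-trans (orbit-sym e≋a) e≋b) (orbit-trans (orbit-sym e′≋a) e′≋b)

      -- Every common vertex is an end of a shared edge and at most one edge is shared, so the
      -- intersection is empty or a single edge.
      by-cases : Dec (Any.Any Shared darts) →
        I ≐ˢ emptySubgraph ⊎ (∃[ v ] I ≐ˢ vertexSubgraph v) ⊎ (∃[ a ] I ≐ˢ edgeSubgraph a)
      by-cases (no ¬shared) = inj₁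
        ( ((λ p → let b , shared , _ = shared-at p in ¬any shared) , λ ())
        , ((λ p → [ ¬any , ¬any ]′ (shared-dart p)) , λ ()))
        where
        ¬any : ∀ {d} → ¬ Shared d
        ¬any {d} shared = ¬shared (lose {P = Shared} (∈-darts d) shared)
      by-cases (yes any) with find any
      ... | a , _ , shared@(e≋a , e′≋a⁻¹) = inj₂ (inj₂ (a , (ends⊆ , ends⊇) , (edge⊆ , edge⊇)))
        where
        ends⊆ : ∀ {v} → vertices I v → v ≡ source a ⊎ v ≡ target a
        ends⊆ p with shared-at p
        ... | b , shared-b , v∈b with shared-unique shared shared-b
        ...   | inj₁ refl = v∈b
        ...   | inj₂ refl = Sum.swap v∈b
        ends⊇ : ∀ {v} → v ≡ source a ⊎ v ≡ target a → vertices I v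
        ends⊇ (inj₁ refl) = (a , e≋a , refl) , (φ (reverse a) , φ-step e′≋a⁻¹ , φ-source (reverse a))
        ends⊇ (inj₂ refl) = (φ a , φ-step e≋a , φ-source a) , (reverse a , e′≋a⁻¹ , refl)
        edge⊆ : ∀ {d} → edges I d → d ≡ a ⊎ d ≡ reverse a
        edge⊆ p with shared-dart p
        ... | inj₁ shared-d   = shared-unique shared shared-d
        ... | inj₂ shared-d⁻¹ = Sum.swap (Sum.map (cong reverse) (cong reverse) (shared-unique shared shared-d⁻¹))
        edge⊇ : ∀ {d} → d ≡ a ⊎ d ≡ reverse a → edges I d
        edge⊇ (inj₁ refl) = inj₁ e≋a , inj₂ e′≋a⁻¹
        edge⊇ (inj₂ refl) = inj₂ e≋a , inj₁ e′≋a⁻¹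

mainTheorem2 : (G : Graph) → Graph.Connected G → Planar G →
    ((E : Embedding G) → Embedding.Polyhedral E → Embedding.genus E ≡ 0ℚ)
    × (Graph.Cubic G → (E : Embedding G) → Multigraph.Simple (Embedding.dual E) → Embedding.genus E ≡ 0ℚ)
mainTheorem2 G connected planar =
    polyhedral-genus G connected planar
  , λ cubic E dual-simple → polyhedral-genus G connected planar E
      (CubicSimpleDual.polyhedral cubic E dual-simple)
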